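{- There is an absolute constant $c>0$ such that if $n$ is sufficiently large and $q$ is an integer with $1 \le q < cn$, then every $n$-vertex graph with $\lfloor n^2/4\rfloor+q$ edges contains at least $$q\left\lfloor \frac{n}{2}\right\rfloor\left(\left\lfloor \frac{n}{2}\right\rfloor-1\right)\left(\left\lceil \frac{n}{2}\right\rceil-2\right)$$ copies of a five cycle $C_5$.
   Context: Graphs are finite and simple. A copy of $C_5$ in a graph $H$ is a set of $5$ vertices and $5$ edges of $H$ forming a (not necessarily induced) subgraph isomorphic to the cycle $C_5$; equivalently, the number of copies of $C_5$ in $H$ is the number of edge-preserving injections $V(C_5)\to V(H)$ divided by the number of automorphisms of $C_5$ (which is $10$). -}

module Defs where

open import Data.Fin using (Fin; toℕ; _<?_; _≟_)
open import Data.Fin.Properties using (all?)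
open import Data.List using (List; []; _∷_; length; filter; allFin; cartesianProduct; cartesianProductWith)
open import Data.Nat using (ℕ; zero; suc; _/_; _%_)
import Data.Nat.Properties as ℕ
open import Data.Product using (proj₁; proj₂)
open import Data.Sum using (_⊎_; swap)
open import Data.Vec using (Vec; []; _∷_; lookup)
open import Function.Definitions using (Injective)
open import Level using (0ℓ)
open import Relation.Binary using (Rel; Decidable; Symmetric)
open import Relation.Binary.PropositionalEquality using (_≡_; refl)
open import Relation.Nullary using (¬_; Dec)
open import Relation.Nullary.Decidable using (_×-dec_; _⊎-dec_; _→-dec_; ¬?; map′; from-yes)

record Graph (n : ℕ) : Set₁ where
  field
    Adj    : Rel (Fin n) 0ℓ
    adj?   : Decidable Adj
    sym    : Symmetric Adj
    irrefl : ∀ i → ¬ Adj i i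

open Graph

-- Each edge is counted once, as the pair of its endpoints in increasing order.
numEdges : ∀ {n} → Graph n → ℕ
numEdges {n} G =
  length (filter (λ p → (proj₁ p <? proj₂ p) ×-dec adj? G (proj₁ p) (proj₂ p))
                 (cartesianProduct (allFin n) (allFin n)))

-- All maps Fin m → Fin n, each listed exactly once as its vector of values.
allMaps : ∀ m n → List (Vec (Fin n) m)
allMaps zero    n = [] ∷ []
allMaps (suc m) n = cartesianProductWith _∷_ (allFin n) (allMaps m n)

InjectiveMap : ∀ {m n} → Vec (Fin n) m → Set
InjectiveMap f = Injective _≡_ _≡_ (lookup f)

injectiveMap? : ∀ {m n} (f : Vec (Fin n) m) → Dec (InjectiveMap f)
injectiveMap? f =
  map′ (λ inj {i} {j} → inj i j) (λ inj i j → inj {i} {j})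
       (all? λ i → all? λ j → (lookup f i ≟ lookup f j) →-dec (i ≟ j))

PreservesEdges : ∀ {m n} → Graph m → Graph n → Vec (Fin n) m → Set
PreservesEdges H G f = ∀ i j → Adj H i j → Adj G (lookup f i) (lookup f j)

preservesEdges? : ∀ {m n} (H : Graph m) (G : Graph n) (f : Vec (Fin n) m) →
                  Dec (PreservesEdges H G f)
preservesEdges? H G f =
  all? λ i → all? λ j → adj? H i j →-dec adj? G (lookup f i) (lookup f j)

ReflectsEdges : ∀ {m n} → Graph m → Graph n → Vec (Fin n) m → Set
ReflectsEdges H G f = ∀ i j → Adj G (lookup f i) (lookup f j) → Adj H i j

reflectsEdges? : ∀ {m n} (H : Graph m) (G : Graph n) (f : Vec (Fin n) m) →
                 Dec (ReflectsEdges H G f)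
reflectsEdges? H G f =
  all? λ i → all? λ j → adj? G (lookup f i) (lookup f j) →-dec adj? H i j

numEmbeddings : ∀ {m n} → Graph m → Graph n → ℕ
numEmbeddings {m} {n} H G =
  length (filter (λ f → injectiveMap? f ×-dec preservesEdges? H G f) (allMaps m n))

-- An injective map Fin m → Fin m is automatically bijective.
numAutomorphisms : ∀ {m} → Graph m → ℕ
numAutomorphisms {m} H =
  length (filter (λ f → injectiveMap? f ×-dec preservesEdges? H H f ×-dec reflectsEdges? H H f)
                 (allMaps m m))

C₅ : Graph 5
C₅ = record
  { Adj    = λ i j → next i j ⊎ next j i
  ; adj?   = adj5?
  ; sym    = swap
  ; irrefl = from-yes (all? λ i → ¬? (adj5? i i))
  }
  where
  next : Fin 5 → Fin 5 → Set
  next i j = toℕ j ≡ suc (toℕ i) % 5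

  adj5? : Decidable (λ i j → next i j ⊎ next j i)
  adj5? i j = (toℕ j ℕ.≟ suc (toℕ i) % 5) ⊎-dec (toℕ i ℕ.≟ suc (toℕ j) % 5)

numAutomorphisms-C₅ : numAutomorphisms C₅ ≡ 10
numAutomorphisms-C₅ = refl

-- Copies of C₅ are not necessarily induced subgraphs; each one is the image of
-- exactly numAutomorphisms C₅ = 10 embeddings, so the division is exact.
numC₅ : ∀ {n} → Graph n → ℕ
numC₅ G = numEmbeddings C₅ G / 10

{-# OPTIONS --safe #-}
-- Suppose G has fewer five-cycles than claimed. A walk of length 3 inside a neighbourhood closes up to a
-- homomorphic image of C₅, so G has few triangles; averaging over x, some partition into N(x) and its
-- complement then has few "bad" edges, that is, edges inside a part. A vertex with many neighbours in
-- both parts would lie on order n⁴ five-cycles, so after moving a few vertices every vertex has at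
-- most 2n/P bad neighbours, for a large constant P. Let M be the number of missing cross pairs and
-- δ = ⌊n/2⌋⌈n/2⌉ − |A||B|, so that there are exactly q + M + δ bad edges. In the absence of missing
-- pairs, a bad edge inside A would lie on |B|(|B|−1)(|A|−2) five-cycles without other bad edges. A
-- missing pair destroys only O(n³/P) of the cycles counted, which is paid for by the M extra bad edges,
-- and the δ further ones pay for the imbalance of the parts.
--
-- Below, pairs are always ordered, so that E, B and M are twice the numbers of edges, bad edges and
-- missing cross pairs.
module Submission where

open import Defs
open import Data.Nat using (ℕ; _+_; _*_; _∸_; _^_; _/_; _≤_; ⌊_/2⌋; ⌈_/2⌉)
open import Data.Integer using (+_)
open import Data.Rational using (ℚ; 0ℚ) renaming (_<_ to _<ℚ_; _*_ to _*ℚ_; _/_ to _/ℚ_)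
open import Data.Product using (∃-syntax; _×_)
open import Relation.Binary.PropositionalEquality using (_≡_)

open import Data.Bool using (Bool; true; false; not; _∧_; _xor_)
open import Data.Fin using (Fin; zero; suc; toℕ; _≟_)
open import Data.Fin.Properties using (any?; toℕ-injective; <-cmp)
import Data.Integer as ℤ
import Data.Integer.Properties as ℤ
open import Data.List using (List; []; _∷_; length; filter; tabulate; map; _++_; cartesianProductWith)
open import Data.List.Properties using (length-++; filter-++)
open import Data.Nat hiding (_≟_; <-cmp)
open import Data.Nat.DivMod using (m≡m%n+[m/n]*n; m%n<n; m/n*n≤m; m*n/n≡m; +-distrib-/-∣ʳ; /-monoˡ-≤)
open import Data.Nat.Divisibility using (divides-refl)
open import Data.Nat.Properties hiding (_≟_; <-cmp)
open import Algebra.Properties.Semiring.Sum +-*-semiring using (sum; sum-cong-≗; ∑-distrib-+; ∑-comm; *-distribˡ-sum; *-distribʳ-sum)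
open import Data.Nat.Tactic.RingSolver using (solve-∀)
open import Data.Product using (_,_; proj₁; proj₂; ∃)
open import Data.Rational.Properties using (toℚᵘ-mono-<; toℚᵘ-homo-*; toℚᵘ-fromℚᵘ; normalize-pos; positive⁻¹)
open import Data.Rational.Unnormalised using (mkℚᵘ; *<*)
import Data.Rational.Unnormalised.Properties as ℚᵘ
open import Data.Sum using (_⊎_; inj₁; inj₂)
open import Data.Vec using (Vec; []; _∷_; lookup)
open import Data.Vec.Relation.Unary.All using ([]; _∷_)
open import Data.Vec.Relation.Unary.Unique.Propositional using (Unique; []; _∷_)
open import Data.Vec.Relation.Unary.Unique.Propositional.Properties using (lookup-injective)
open import Function using (_∘_; id)
open import Level using (0ℓ)
open import Relation.Binary.Definitions using (tri<; tri≈; tri>)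
open import Relation.Binary.PropositionalEquality
open import Relation.Nullary using (Dec; yes; no; does; contradiction; ¬_)
open import Relation.Nullary.Decidable using (_×-dec_; dec-true; dec-false; from-yes)
open import Relation.Unary using (Pred) renaming (Decidable to Decidable₁)

-- The bound to be proved is exact, so the final count may contain no error term, while the search
-- for the partition may be as wasteful as convenient. The assumption of few five-cycles therefore
-- serves only that search, where it is used in the weak form that the number of embedded
-- five-cycles is at most n⁴/Q. Once all bad degrees are at most 2n/P, the count is direct and
-- accounts for every coincidence of vertices exactly. The constants are fixed from the end of the
-- argument backwards. P = 2^14 makes the cycles lost per missing pair no more than the cycles
-- gained per bad edge. Q = 128P² forbids a vertex to have more than n/P neighbours in each part. A
-- bound q < n/(10Q) turns the assumption into the n⁴/Q above. Finally D, of order n/Q, is a cut-off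
-- for codegrees in the triangle estimate, and it has to exceed 384Q², which dictates how large n
-- must be.

-- Sums over Fin n

-- Opaque so that the summand of a sum can be recovered by unification.
opaque

  ∑ : ∀ {n} → (Fin n → ℕ) → ℕ
  ∑ = sum

  ∑-cong : ∀ {n} {f g : Fin n → ℕ} → (∀ i → f i ≡ g i) → ∑ f ≡ ∑ g
  ∑-cong = sum-cong-≗

  ∑-mono : ∀ {n} {f g : Fin n → ℕ} → (∀ i → f i ≤ g i) → ∑ f ≤ ∑ g
  ∑-mono {zero}  h = z≤n
  ∑-mono {suc n} h = +-mono-≤ (h zero) (∑-mono (h ∘ suc))

  ∑-+ : ∀ {n} (f g : Fin n → ℕ) → ∑ (λ i → f i + g i) ≡ ∑ f + ∑ g
  ∑-+ = ∑-distrib-+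

  ∑-swap : ∀ {m n} (f : Fin m → Fin n → ℕ) → ∑ (λ i → ∑ (f i)) ≡ ∑ (λ j → ∑ λ i → f i j)
  ∑-swap = ∑-comm

  ∑-*ˡ : ∀ {n} c (f : Fin n → ℕ) → ∑ (λ i → c * f i) ≡ c * ∑ f
  ∑-*ˡ c f = sym (*-distribˡ-sum c f)

  ∑-*ʳ : ∀ {n} c (f : Fin n → ℕ) → ∑ (λ i → f i * c) ≡ ∑ f * c
  ∑-*ʳ c f = sym (*-distribʳ-sum c f)

  ∑-const : ∀ {n} c → ∑ {n} (λ _ → c) ≡ n * c
  ∑-const {zero}  c = refl
  ∑-const {suc n} c = cong (λ t → c + t) (∑-const {n} c)

  term≤∑ : ∀ {n} (f : Fin n → ℕ) i → f i ≤ ∑ f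
  term≤∑ f zero    = m≤m+n _ _
  term≤∑ f (suc i) = ≤-trans (term≤∑ (f ∘ suc) i) (m≤n+m _ _)

  ∑-single : ∀ {n} (f : Fin n → ℕ) i → (∀ j → i ≢ j → f j ≡ 0) → ∑ f ≡ f i
  ∑-single {suc n} f zero    h =
    trans (cong (λ t → f zero + t) (trans (∑-cong λ j → h (suc j) λ ()) (∑-const {n} 0)))
          (trans (cong (λ t → f zero + t) (*-zeroʳ n)) (+-identityʳ _))
  ∑-single f (suc i) h =
    cong₂ _+_ (h zero λ ()) (∑-single (f ∘ suc) i λ j i≢j → h (suc j) λ { refl → i≢j refl })

∑-bound : ∀ {n} {f : Fin n → ℕ} {c} → (∀ i → f i ≤ c) → ∑ f ≤ n * c
∑-bound h = ≤-trans (∑-mono h) (≤-reflexive (∑-const _))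

pigeonhole : ∀ {n} .{{_ : NonZero n}} (f : Fin n → ℕ) → ∃ λ i → n * f i ≤ ∑ f
pigeonhole {n} f with any? (λ i → n * f i ≤? ∑ f)
... | yes found = found
... | no ¬found = contradiction large (<⇒≱ (*-monoʳ-< n (n<1+n (∑ f))))
  where
  open ≤-Reasoning
  large : n * suc (∑ f) ≤ n * ∑ f
  large = begin
    n * suc (∑ f)           ≡⟨ ∑-const (suc (∑ f)) ⟨
    ∑ {n} (λ _ → suc (∑ f)) ≤⟨ ∑-mono (λ i → ≰⇒> (λ h → ¬found (i , h))) ⟩
    ∑ (λ i → n * f i)       ≡⟨ ∑-*ˡ n f ⟩
    n * ∑ f                 ∎

module _ {n : ℕ} where

  Σ₂ : (Fin n → Fin n → ℕ) → ℕ
  Σ₂ f = ∑ λ i → ∑ λ j → f i j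

  Σ₃ : (Fin n → Fin n → Fin n → ℕ) → ℕ
  Σ₃ f = ∑ λ i → Σ₂ (f i)

  Σ₄ : (Fin n → Fin n → Fin n → Fin n → ℕ) → ℕ
  Σ₄ f = ∑ λ i → Σ₃ (f i)

  Σ₅ : (Fin n → Fin n → Fin n → Fin n → Fin n → ℕ) → ℕ
  Σ₅ f = ∑ λ i → Σ₄ (f i)

  Σ₂-mono : ∀ {f g} → (∀ i j → f i j ≤ g i j) → Σ₂ f ≤ Σ₂ g
  Σ₂-mono h = ∑-mono λ i → ∑-mono (h i)

  Σ₃-mono : ∀ {f g} → (∀ i j k → f i j k ≤ g i j k) → Σ₃ f ≤ Σ₃ g
  Σ₃-mono h = ∑-mono λ i → Σ₂-mono (h i)

  Σ₄-mono : ∀ {f g} → (∀ i j k l → f i j k l ≤ g i j k l) → Σ₄ f ≤ Σ₄ g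
  Σ₄-mono h = ∑-mono λ i → Σ₃-mono (h i)

  Σ₅-mono : ∀ {f g} → (∀ i j k l m → f i j k l m ≤ g i j k l m) → Σ₅ f ≤ Σ₅ g
  Σ₅-mono h = ∑-mono λ i → Σ₄-mono (h i)

  Σ₂-cong : ∀ {f g} → (∀ i j → f i j ≡ g i j) → Σ₂ f ≡ Σ₂ g
  Σ₂-cong h = ∑-cong λ i → ∑-cong (h i)

  Σ₃-cong : ∀ {f g} → (∀ i j k → f i j k ≡ g i j k) → Σ₃ f ≡ Σ₃ g
  Σ₃-cong h = ∑-cong λ i → Σ₂-cong (h i)

  Σ₂-+ : ∀ f g → Σ₂ (λ i j → f i j + g i j) ≡ Σ₂ f + Σ₂ g
  Σ₂-+ f g = trans (∑-cong λ i → ∑-+ (f i) (g i)) (∑-+ _ _)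

  Σ₃-+ : ∀ f g → Σ₃ (λ i j k → f i j k + g i j k) ≡ Σ₃ f + Σ₃ g
  Σ₃-+ f g = trans (∑-cong λ i → Σ₂-+ (f i) (g i)) (∑-+ _ _)

  Σ₄-+ : ∀ f g → Σ₄ (λ i j k l → f i j k l + g i j k l) ≡ Σ₄ f + Σ₄ g
  Σ₄-+ f g = trans (∑-cong λ i → Σ₃-+ (f i) (g i)) (∑-+ _ _)

  Σ₅-+ : ∀ f g → Σ₅ (λ i j k l m → f i j k l m + g i j k l m) ≡ Σ₅ f + Σ₅ g
  Σ₅-+ f g = trans (∑-cong λ i → Σ₄-+ (f i) (g i)) (∑-+ _ _)

  Σ₂-swap : ∀ f → Σ₂ f ≡ Σ₂ (λ j i → f i j)
  Σ₂-swap f = ∑-swap f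

  Σ₂-*ˡ : ∀ c f → Σ₂ (λ i j → c * f i j) ≡ c * Σ₂ f
  Σ₂-*ˡ c f = trans (∑-cong λ i → ∑-*ˡ c (f i)) (∑-*ˡ c _)

  Σ₃-*ˡ : ∀ c f → Σ₃ (λ i j k → c * f i j k) ≡ c * Σ₃ f
  Σ₃-*ˡ c f = trans (∑-cong λ i → Σ₂-*ˡ c (f i)) (∑-*ˡ c _)

  Σ₂-const : ∀ c → Σ₂ (λ _ _ → c) ≡ n * (n * c)
  Σ₂-const c = trans (∑-cong {n} λ _ → ∑-const c) (∑-const (n * c))

  Σ₂-* : ∀ f g → Σ₂ (λ i j → f i * g j) ≡ ∑ f * ∑ g
  Σ₂-* f g = trans (∑-cong λ i → ∑-*ˡ (f i) g) (∑-*ʳ (∑ g) f)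

  Σ₅-rotate : ∀ f → Σ₅ (λ i j k l m → f j k l m i) ≡ Σ₅ f
  Σ₅-rotate f =
    trans (∑-swap λ i j → Σ₃ λ k l m → f j k l m i) (∑-cong λ j →
    trans (∑-swap λ i k → Σ₂ λ l m → f j k l m i) (∑-cong λ k →
    trans (∑-swap λ i l → ∑ λ m → f j k l m i) (∑-cong λ l →
    ∑-swap λ i m → f j k l m i)))

-- Indicators and counting

𝟙 : Bool → ℕ
𝟙 true  = 1
𝟙 false = 0

𝟙≤1 : ∀ b → 𝟙 b ≤ 1
𝟙≤1 true  = ≤-refl
𝟙≤1 false = z≤n

module _ {A B : Set} where

  length-filter-map : ∀ {P : Pred B 0ℓ} (P? : Decidable₁ P) (f : A → B) xs →
    length (filter P? (map f xs)) ≡ length (filter (λ x → P? (f x)) xs)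
  length-filter-map P? f [] = refl
  length-filter-map P? f (x ∷ xs) with does (P? (f x))
  ... | true  = cong suc (length-filter-map P? f xs)
  ... | false = length-filter-map P? f xs

opaque
  unfolding ∑

  -- A general `tabulate g` replaces `allFin` because the tail of `allFin (suc n)` is a tabulation
  -- of `suc`, so induction needs `g` to vary.
  length-filter-cartesianProductWith :
    ∀ {A B C : Set} {P : Pred C 0ℓ} (P? : Decidable₁ P) (f : A → B → C) {n} (g : Fin n → A) ys →
    length (filter P? (cartesianProductWith f (tabulate g) ys)) ≡
    ∑ (λ i → length (filter (λ y → P? (f (g i) y)) ys))
  length-filter-cartesianProductWith P? f {zero}  g ys = refl
  length-filter-cartesianProductWith {C = C} P? f {suc n} g ys = begin
    length (filter P? (map (f (g zero)) ys ++ rest))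
      ≡⟨ cong length (filter-++ P? (map (f (g zero)) ys) rest) ⟩
    length (filter P? (map (f (g zero)) ys) ++ filter P? rest)
      ≡⟨ length-++ (filter P? (map (f (g zero)) ys)) ⟩
    length (filter P? (map (f (g zero)) ys)) + length (filter P? rest)
      ≡⟨ cong₂ _+_ (length-filter-map P? (f (g zero)) ys)
                   (length-filter-cartesianProductWith P? f (g ∘ suc) ys) ⟩
    _ ∎
    where
    open ≡-Reasoning
    rest : List C
    rest = cartesianProductWith f (tabulate (g ∘ suc)) ys

  length-filter-tabulate :
    ∀ {A : Set} {P : Pred A 0ℓ} (P? : Decidable₁ P) {n} (g : Fin n → A) →
    length (filter P? (tabulate g)) ≡ ∑ (λ i → 𝟙 (does (P? (g i))))
  length-filter-tabulate P? {zero}  g = refl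
  length-filter-tabulate P? {suc n} g with does (P? (g zero))
  ... | true  = cong suc (length-filter-tabulate P? (g ∘ suc))
  ... | false = length-filter-tabulate P? (g ∘ suc)

length-filter-singleton :
  ∀ {A : Set} {P : Pred A 0ℓ} (P? : Decidable₁ P) x → length (filter P? (x ∷ [])) ≡ 𝟙 (does (P? x))
length-filter-singleton P? x with does (P? x)
... | true  = refl
... | false = refl

witness : ∀ {A : Set} (a? : Dec A) → does a? ≡ true → A
witness (yes a) _ = a

refutation : ∀ {A : Set} (a? : Dec A) → does a? ≡ false → ¬ A
refutation (no ¬a) _ = ¬a

-- Embeddings of the 5-cycle

-- `C₅` gives adjacency as an equation modulo 5. Solving it for the successor leaves five cases to
-- check in place of twenty-five pairs.
next₅ : Fin 5 → Fin 5
next₅ zero = suc zero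
next₅ (suc zero) = suc (suc zero)
next₅ (suc (suc zero)) = suc (suc (suc zero))
next₅ (suc (suc (suc zero))) = suc (suc (suc (suc zero)))
next₅ (suc (suc (suc (suc zero)))) = zero

toℕ-next₅ : ∀ i → toℕ (next₅ i) ≡ suc (toℕ i) % 5
toℕ-next₅ zero = refl
toℕ-next₅ (suc zero) = refl
toℕ-next₅ (suc (suc zero)) = refl
toℕ-next₅ (suc (suc (suc zero))) = refl
toℕ-next₅ (suc (suc (suc (suc zero)))) = refl

module _ {n : ℕ} where

  ne : Fin n → Fin n → Bool
  ne u v = not (does (u ≟ v))

  ne-≢ : ∀ {u v} → u ≢ v → ne u v ≡ true
  ne-≢ {u} {v} u≢v = cong not (dec-false (u ≟ v) u≢v)

  ne-sym : ∀ u v → ne u v ≡ ne v u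
  ne-sym u v with u ≟ v
  ... | yes refl = cong not (sym (dec-true (u ≟ u) refl))
  ... | no u≢v   = sym (ne-≢ (u≢v ∘ sym))

  ≢-ne : ∀ u v → ne u v ≡ true → u ≢ v
  ≢-ne u v h with no u≢v ← u ≟ v = u≢v

  ∑-eq : ∀ u → ∑ (λ v → 𝟙 (not (ne u v))) ≡ 1
  ∑-eq u = trans (∑-single _ u λ j u≢j → cong (𝟙 ∘ not) (ne-≢ u≢j)) at
    where
    at : 𝟙 (not (ne u u)) ≡ 1
    at rewrite dec-true (u ≟ u) refl = refl

module Embeddings {n : ℕ} (G : Graph n) where
  open Graph G renaming (sym to Adj-sym)

  adj : Fin n → Fin n → Bool
  adj u v = does (adj? u v)

  adj-sound : ∀ u v → adj u v ≡ true → Adj u v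
  adj-sound u v = witness (adj? u v)

  adj-irrefl : ∀ u → adj u u ≡ false
  adj-irrefl u = dec-false (adj? u u) (irrefl u)

  adj-sym : ∀ u v → adj u v ≡ adj v u
  adj-sym u v with adj? u v
  ... | yes uv = sym (dec-true (adj? v u) (Adj-sym uv))
  ... | no ¬uv = sym (dec-false (adj? v u) (¬uv ∘ Adj-sym))

  adj⇒≢ : ∀ u v → adj u v ≡ true → u ≢ v
  adj⇒≢ u v h refl = irrefl u (adj-sound u u h)

  -- Consecutive vertices differ because they are adjacent, so only the other five pairs are tested.
  hom cyc : (i j k l m : Fin n) → ℕ
  hom i j k l m = 𝟙 (adj i j) * 𝟙 (adj j k) * 𝟙 (adj k l) * 𝟙 (adj l m) * 𝟙 (adj m i)
  cyc i j k l m = hom i j k l m *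
    (𝟙 (ne i k) * 𝟙 (ne i l) * 𝟙 (ne j l) * 𝟙 (ne j m) * 𝟙 (ne k m))

  cyc-rotate : ∀ i j k l m → cyc j k l m i ≡ cyc i j k l m
  cyc-rotate i j k l m
    rewrite ne-sym j l | ne-sym k i | ne-sym l i =
    shuffle (𝟙 (adj i j)) (𝟙 (adj j k)) (𝟙 (adj k l)) (𝟙 (adj l m)) (𝟙 (adj m i))
            (𝟙 (ne i k)) (𝟙 (ne i l)) (𝟙 (ne l j)) (𝟙 (ne j m)) (𝟙 (ne k m))
    where
    shuffle : ∀ a b c d e p q r s t →
      b * c * d * e * a * (r * s * t * p * q) ≡ a * b * c * d * e * (p * q * r * s * t)
    shuffle = solve-∀

  private
    Emb? : (f : Vec (Fin n) 5) → Dec (InjectiveMap f × PreservesEdges C₅ G f)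
    Emb? f = injectiveMap? f ×-dec preservesEdges? C₅ G f

    cycle-embeds : ∀ {i j k l m} →
      adj i j ≡ true → adj j k ≡ true → adj k l ≡ true → adj l m ≡ true → adj m i ≡ true →
      ne i k ≡ true → ne i l ≡ true → ne j l ≡ true → ne j m ≡ true → ne k m ≡ true →
      InjectiveMap (i ∷ j ∷ k ∷ l ∷ m ∷ []) × PreservesEdges C₅ G (i ∷ j ∷ k ∷ l ∷ m ∷ [])
    cycle-embeds {i} {j} {k} {l} {m} ij jk kl lm mi ik il jl jm km = inj , pres
      where
      f = i ∷ j ∷ k ∷ l ∷ m ∷ []
      unique : Unique f
      unique =
        (adj⇒≢ i j ij ∷ ≢-ne i k ik ∷ ≢-ne i l il ∷ adj⇒≢ m i mi ∘ sym ∷ []) ∷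
        (adj⇒≢ j k jk ∷ ≢-ne j l jl ∷ ≢-ne j m jm ∷ []) ∷
        (adj⇒≢ k l kl ∷ ≢-ne k m km ∷ []) ∷ (adj⇒≢ l m lm ∷ []) ∷ [] ∷ []
      inj : InjectiveMap f
      inj {x} {y} = lookup-injective unique x y
      forward : ∀ x → Adj (lookup f x) (lookup f (next₅ x))
      forward zero = adj-sound i j ij
      forward (suc zero) = adj-sound j k jk
      forward (suc (suc zero)) = adj-sound k l kl
      forward (suc (suc (suc zero))) = adj-sound l m lm
      forward (suc (suc (suc (suc zero)))) = adj-sound m i mi
      step : ∀ x y → toℕ y ≡ suc (toℕ x) % 5 → Adj (lookup f x) (lookup f y)
      step x y h rewrite toℕ-injective {i = y} {next₅ x} (trans h (sym (toℕ-next₅ x))) = forward x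
      pres : PreservesEdges C₅ G f
      pres x y (inj₁ xy) = step x y xy
      pres x y (inj₂ yx) = Adj-sym (step y x yx)

    cyc≤embedding : ∀ i j k l m → cyc i j k l m ≤ 𝟙 (does (Emb? (i ∷ j ∷ k ∷ l ∷ m ∷ [])))
    cyc≤embedding i j k l m =
      go (cycle-embeds {i} {j} {k} {l} {m})
      where
      go : ∀ {a b c d e p q r s t} →
        (a ≡ true → b ≡ true → c ≡ true → d ≡ true → e ≡ true →
         p ≡ true → q ≡ true → r ≡ true → s ≡ true → t ≡ true →
         InjectiveMap (i ∷ j ∷ k ∷ l ∷ m ∷ []) × PreservesEdges C₅ G (i ∷ j ∷ k ∷ l ∷ m ∷ [])) →
        𝟙 a * 𝟙 b * 𝟙 c * 𝟙 d * 𝟙 e * (𝟙 p * 𝟙 q * 𝟙 r * 𝟙 s * 𝟙 t) ≤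
        𝟙 (does (Emb? (i ∷ j ∷ k ∷ l ∷ m ∷ [])))
      go {false} h = z≤n
      go {true} {false} h = z≤n
      go {true} {true} {false} h = z≤n
      go {true} {true} {true} {false} h = z≤n
      go {true} {true} {true} {true} {false} h = z≤n
      go {true} {true} {true} {true} {true} {false} h = z≤n
      go {true} {true} {true} {true} {true} {true} {false} h = z≤n
      go {true} {true} {true} {true} {true} {true} {true} {false} h = z≤n
      go {true} {true} {true} {true} {true} {true} {true} {true} {false} h = z≤n
      go {true} {true} {true} {true} {true} {true} {true} {true} {true} {false} h = z≤n
      go {true} {true} {true} {true} {true} {true} {true} {true} {true} {true} h
        rewrite dec-true (Emb? (i ∷ j ∷ k ∷ l ∷ m ∷ [])) (h refl refl refl refl refl refl refl refl refl refl)
        = ≤-refl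

  Σcyc≤numEmbeddings : Σ₅ cyc ≤ numEmbeddings C₅ G
  Σcyc≤numEmbeddings = ≤-trans (Σ₅-mono cyc≤embedding) (≤-reflexive (sym count))
    where
    open ≡-Reasoning
    count : numEmbeddings C₅ G ≡ Σ₅ λ i j k l m → 𝟙 (does (Emb? (i ∷ j ∷ k ∷ l ∷ m ∷ [])))
    count =
      trans (length-filter-cartesianProductWith Emb? _∷_ id (allMaps 4 n)) (∑-cong λ i →
      trans (length-filter-cartesianProductWith (λ f → Emb? (i ∷ f)) _∷_ id (allMaps 3 n)) (∑-cong λ j →
      trans (length-filter-cartesianProductWith (λ f → Emb? (i ∷ j ∷ f)) _∷_ id (allMaps 2 n)) (∑-cong λ k →
      trans (length-filter-cartesianProductWith (λ f → Emb? (i ∷ j ∷ k ∷ f)) _∷_ id (allMaps 1 n)) (∑-cong λ l →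
      trans (length-filter-cartesianProductWith (λ f → Emb? (i ∷ j ∷ k ∷ l ∷ f)) _∷_ id (allMaps 0 n)) (∑-cong λ m →
      length-filter-singleton (λ f → Emb? (i ∷ j ∷ k ∷ l ∷ m ∷ f)) [])))))

  E : ℕ
  E = Σ₂ λ u v → 𝟙 (adj u v)

  E≡2*numEdges : E ≡ 2 * numEdges G
  E≡2*numEdges = begin
    E
      ≡⟨ Σ₂-cong split ⟩
    Σ₂ (λ u v → ordered u v + ordered v u)
      ≡⟨ Σ₂-+ ordered (λ u v → ordered v u) ⟩
    Σ₂ ordered + Σ₂ (λ u v → ordered v u)
      ≡⟨ cong (λ t → Σ₂ ordered + t) (sym (Σ₂-swap ordered)) ⟩
    Σ₂ ordered + Σ₂ ordered
      ≡⟨ cong (λ t → Σ₂ ordered + t) (+-identityʳ _) ⟨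
    2 * Σ₂ ordered
      ≡⟨ cong (2 *_) count ⟨
    2 * numEdges G ∎
    where
    open ≡-Reasoning
    Ordered? : ∀ p → Dec _
    Ordered? p = (proj₁ p Data.Fin.<? proj₂ p) ×-dec adj? (proj₁ p) (proj₂ p)
    ordered : Fin n → Fin n → ℕ
    ordered u v = 𝟙 (does (u Data.Fin.<? v) ∧ adj u v)
    count : numEdges G ≡ Σ₂ ordered
    count = trans (length-filter-cartesianProductWith Ordered? _,_ id _)
      (∑-cong λ u → length-filter-tabulate (λ v → Ordered? (u , v)) id)
    split : ∀ u v → 𝟙 (adj u v) ≡ ordered u v + ordered v u
    split u v with <-cmp u v
    ... | tri< u<v _ v≮u
      rewrite dec-true (u Data.Fin.<? v) u<v | dec-false (v Data.Fin.<? u) v≮u = sym (+-identityʳ _)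
    ... | tri≈ u≮u refl _
      rewrite dec-false (u Data.Fin.<? u) u≮u = cong 𝟙 (adj-irrefl u)
    ... | tri> u≮v _ v<u
      rewrite dec-false (u Data.Fin.<? v) u≮v | dec-true (v Data.Fin.<? u) v<u = cong 𝟙 (adj-sym u v)

-- Partitions into two parts, given by s : Fin n → Bool

∀-Bool? : {P : Bool → Set} → (∀ b → Dec (P b)) → Dec (∀ b → P b)
∀-Bool? P? with P? true | P? false
... | yes t | yes f = yes λ { true → t ; false → f }
... | no ¬t | _     = no λ h → ¬t (h true)
... | _     | no ¬f = no λ h → ¬f (h false)

xor-comm : ∀ x y → x xor y ≡ y xor x
xor-comm true  true  = refl
xor-comm true  false = refl
xor-comm false true  = refl
xor-comm false false = refl

oneBad : (a b c d e : Bool) → ℕ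
oneBad a b c d e = 𝟙 (not (a xor b) ∧ (b xor c) ∧ (c xor d) ∧ (d xor e) ∧ (e xor a))

oneBad-unique : ∀ a b c d e →
  oneBad a b c d e + oneBad b c d e a + oneBad c d e a b + oneBad d e a b c + oneBad e a b c d ≤ 1
oneBad-unique = from-yes
  (∀-Bool? λ a → ∀-Bool? λ b → ∀-Bool? λ c → ∀-Bool? λ d → ∀-Bool? λ e →
   oneBad a b c d e + oneBad b c d e a + oneBad c d e a b + oneBad d e a b c + oneBad e a b c d ≤? 1)

module Partition {n : ℕ} (G : Graph n) (s : Fin n → Bool) where
  open Embeddings G

  same opp bad mis : Fin n → Fin n → Bool
  same u v = not (s u xor s v)
  opp  u v = s u xor s v
  bad  u v = adj u v ∧ same u v
  mis  u v = not (adj u v) ∧ opp u v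

  badDeg misDeg insize outsize : Fin n → ℕ
  badDeg  u = ∑ λ v → 𝟙 (bad u v)
  misDeg  u = ∑ λ v → 𝟙 (mis u v)
  insize  u = ∑ λ v → 𝟙 (same u v)
  outsize u = ∑ λ v → 𝟙 (opp u v)

  B M p r : ℕ
  B = ∑ badDeg
  M = ∑ misDeg
  p = ∑ λ v → 𝟙 (s v)
  r = ∑ λ v → 𝟙 (not (s v))

  bad-sym : ∀ u v → bad u v ≡ bad v u
  bad-sym u v = cong₂ (λ x y → x ∧ not y) (adj-sym u v) (xor-comm (s u) (s v))

  mis-sym : ∀ u v → mis u v ≡ mis v u
  mis-sym u v = cong₂ (λ x y → not x ∧ y) (adj-sym u v) (xor-comm (s u) (s v))

  p+r≡n : p + r ≡ n
  p+r≡n = begin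
    p + r                              ≡⟨ ∑-+ _ _ ⟨
    ∑ (λ v → 𝟙 (s v) + 𝟙 (not (s v))) ≡⟨ ∑-cong (λ v → one (s v)) ⟩
    ∑ {n} (λ _ → 1)                    ≡⟨ ∑-const 1 ⟩
    n * 1                              ≡⟨ *-identityʳ n ⟩
    n                                  ∎
    where
    open ≡-Reasoning
    one : ∀ b → 𝟙 b + 𝟙 (not b) ≡ 1
    one true  = refl
    one false = refl

  sizes-true : ∀ u → s u ≡ true → insize u ≡ p × outsize u ≡ r
  sizes-true u h rewrite h = ∑-cong (λ v → cong 𝟙 (lem (s v))) , refl
    where
    lem : ∀ b → not (not b) ≡ b
    lem true  = refl
    lem false = refl

  sizes-false : ∀ u → s u ≡ false → insize u ≡ r × outsize u ≡ p
  sizes-false u h rewrite h = refl , refl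

  -- Both sides count the ordered pairs that are edges or cross pairs: as edges plus missing cross
  -- pairs, and as cross pairs plus edges inside a part.
  E+M≡2pr+B : E + M ≡ 2 * (p * r) + B
  E+M≡2pr+B = begin
    E + M
      ≡⟨ Σ₂-+ (λ u v → 𝟙 (adj u v)) (λ u v → 𝟙 (mis u v)) ⟨
    Σ₂ (λ u v → 𝟙 (adj u v) + 𝟙 (mis u v))
      ≡⟨ Σ₂-cong (λ u v → pointwise (adj u v) (s u) (s v)) ⟩
    Σ₂ (λ u v → 𝟙 (s u) * 𝟙 (not (s v)) + 𝟙 (not (s u)) * 𝟙 (s v) + 𝟙 (bad u v))
      ≡⟨ Σ₂-+ _ _ ⟩
    Σ₂ (λ u v → 𝟙 (s u) * 𝟙 (not (s v)) + 𝟙 (not (s u)) * 𝟙 (s v)) + B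
      ≡⟨ cong (_+ B) (Σ₂-+ _ _) ⟩
    Σ₂ (λ u v → 𝟙 (s u) * 𝟙 (not (s v))) + Σ₂ (λ u v → 𝟙 (not (s u)) * 𝟙 (s v)) + B
      ≡⟨ cong (_+ B) (cong₂ _+_ (Σ₂-* _ _) (Σ₂-* _ _)) ⟩
    p * r + r * p + B
      ≡⟨ double p r B ⟩
    2 * (p * r) + B ∎
    where
    open ≡-Reasoning
    double : ∀ p r B → p * r + r * p + B ≡ 2 * (p * r) + B
    double = solve-∀
    pointwise : ∀ a x y → 𝟙 a + 𝟙 (not a ∧ (x xor y)) ≡
      𝟙 x * 𝟙 (not y) + 𝟙 (not x) * 𝟙 y + 𝟙 (a ∧ not (x xor y))
    pointwise true  true  true  = refl
    pointwise true  true  false = refl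
    pointwise true  false true  = refl
    pointwise true  false false = refl
    pointwise false true  true  = refl
    pointwise false true  false = refl
    pointwise false false true  = refl
    pointwise false false false = refl

  -- 5-cycles i j k l m in which ij is the only edge inside a part.
  cyc₁ : (i j k l m : Fin n) → ℕ
  cyc₁ i j k l m = oneBad (s i) (s j) (s k) (s l) (s m) * cyc i j k l m

  W : ℕ
  W = Σ₅ cyc₁

  -- The unique edge inside a part can be any of the five edges of the cycle.
  5W≤Σcyc : 5 * W ≤ Σ₅ cyc
  5W≤Σcyc = begin
    5 * W
      ≡⟨ five W ⟩
    W + W + W + W + W
      ≡⟨ cong₂ _+_ (cong₂ _+_ (cong₂ _+_ (cong (λ t → W + t) rot₁) rot₂) rot₃) rot₄ ⟨
    W + Σ₅ (λ i j k l m → cyc₁ j k l m i) + Σ₅ (λ i j k l m → cyc₁ k l m i j)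
      + Σ₅ (λ i j k l m → cyc₁ l m i j k) + Σ₅ (λ i j k l m → cyc₁ m i j k l)
      ≡⟨ cong (λ x → x + Σ₅ (λ i j k l m → cyc₁ k l m i j) + Σ₅ (λ i j k l m → cyc₁ l m i j k)
                   + Σ₅ (λ i j k l m → cyc₁ m i j k l)) (Σ₅-+ _ _) ⟨
    Σ₅ (λ i j k l m → cyc₁ i j k l m + cyc₁ j k l m i) + Σ₅ (λ i j k l m → cyc₁ k l m i j)
      + Σ₅ (λ i j k l m → cyc₁ l m i j k) + Σ₅ (λ i j k l m → cyc₁ m i j k l)
      ≡⟨ cong (λ x → x + Σ₅ (λ i j k l m → cyc₁ l m i j k) + Σ₅ (λ i j k l m → cyc₁ m i j k l)) (Σ₅-+ _ _) ⟨
    Σ₅ (λ i j k l m → cyc₁ i j k l m + cyc₁ j k l m i + cyc₁ k l m i j)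
      + Σ₅ (λ i j k l m → cyc₁ l m i j k) + Σ₅ (λ i j k l m → cyc₁ m i j k l)
      ≡⟨ cong (_+ Σ₅ (λ i j k l m → cyc₁ m i j k l)) (Σ₅-+ _ _) ⟨
    Σ₅ (λ i j k l m → cyc₁ i j k l m + cyc₁ j k l m i + cyc₁ k l m i j + cyc₁ l m i j k)
      + Σ₅ (λ i j k l m → cyc₁ m i j k l)
      ≡⟨ Σ₅-+ _ _ ⟨
    Σ₅ (λ i j k l m →
      cyc₁ i j k l m + cyc₁ j k l m i + cyc₁ k l m i j + cyc₁ l m i j k + cyc₁ m i j k l)
      ≤⟨ Σ₅-mono pointwise ⟩
    Σ₅ cyc ∎
    where
    open ≤-Reasoning
    five : ∀ w → 5 * w ≡ w + w + w + w + w
    five = solve-∀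
    rot₁ : Σ₅ (λ i j k l m → cyc₁ j k l m i) ≡ W
    rot₁ = Σ₅-rotate cyc₁
    rot₂ : Σ₅ (λ i j k l m → cyc₁ k l m i j) ≡ W
    rot₂ = trans (Σ₅-rotate (λ i j k l m → cyc₁ j k l m i)) rot₁
    rot₃ : Σ₅ (λ i j k l m → cyc₁ l m i j k) ≡ W
    rot₃ = trans (Σ₅-rotate (λ i j k l m → cyc₁ k l m i j)) rot₂
    rot₄ : Σ₅ (λ i j k l m → cyc₁ m i j k l) ≡ W
    rot₄ = trans (Σ₅-rotate (λ i j k l m → cyc₁ l m i j k)) rot₃
    distrib : ∀ a b c d e x → a * x + b * x + c * x + d * x + e * x ≡ (a + b + c + d + e) * x
    distrib = solve-∀
    pointwise : ∀ i j k l m →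
      cyc₁ i j k l m + cyc₁ j k l m i + cyc₁ k l m i j + cyc₁ l m i j k + cyc₁ m i j k l ≤ cyc i j k l m
    pointwise i j k l m
      rewrite cyc-rotate m i j k l | cyc-rotate l m i j k | cyc-rotate k l m i j | cyc-rotate j k l m i
            | cyc-rotate i j k l m = begin
      _ ≡⟨ distrib (oneBad (s i) (s j) (s k) (s l) (s m)) (oneBad (s j) (s k) (s l) (s m) (s i))
                   (oneBad (s k) (s l) (s m) (s i) (s j)) (oneBad (s l) (s m) (s i) (s j) (s k))
                   (oneBad (s m) (s i) (s j) (s k) (s l)) _ ⟩
      _ ≤⟨ *-monoˡ-≤ _ (oneBad-unique (s i) (s j) (s k) (s l) (s m)) ⟩
      1 * _ ≡⟨ *-identityˡ _ ⟩
      _ ∎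

-- Five-cycles through a bad edge, and through a vertex with neighbours in both parts

module _ {n : ℕ} where

  separated : (s : Fin n → Bool) → ∀ u v → s u xor s v ≡ true → ne u v ≡ true
  separated s u v h = ne-≢ {u = u} {v} λ { refl → contradiction (trans (sym (xor-self (s u))) h) λ () }
    where
    xor-self : ∀ x → x xor x ≡ false
    xor-self true  = refl
    xor-self false = refl

-- Fix an edge uv inside a part, b and b′ opposite to it and a on its side.
extendBad : ∀ su sv sb sa sb′ uv vb ba ab′ b′u ub ua va vb′ bb′ →
  uv ∧ not (su xor sv) ≡ true → (su xor sb ≡ true → ub ≡ true) → (sv xor sb′ ≡ true → vb′ ≡ true) →
  𝟙 (su xor sb) * (𝟙 (not (su xor sa)) * 𝟙 ua * 𝟙 va) * (𝟙 (su xor sb′) * 𝟙 bb′) ≤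
  𝟙 (not vb ∧ (sv xor sb)) + (𝟙 (not ba ∧ (sb xor sa)) +
  (𝟙 (not ab′ ∧ (sa xor sb′)) + (𝟙 (not b′u ∧ (sb′ xor su)) +
  oneBad su sv sb sa sb′ * (𝟙 uv * 𝟙 vb * 𝟙 ba * 𝟙 ab′ * 𝟙 b′u *
                            (𝟙 ub * 𝟙 ua * 𝟙 va * 𝟙 vb′ * 𝟙 bb′)))))
extendBad true true true sa sb′ true vb ba ab′ b′u ub ua va vb′ bb′ refl h₁ h₂ = z≤n
extendBad true true false false sb′ true vb ba ab′ b′u ub ua va vb′ bb′ refl h₁ h₂ = z≤n
extendBad true true false true sb′ true vb ba ab′ b′u ub false va vb′ bb′ refl h₁ h₂ = z≤n
extendBad true true false true sb′ true vb ba ab′ b′u ub true false vb′ bb′ refl h₁ h₂ = z≤n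
extendBad true true false true true true vb ba ab′ b′u ub true true vb′ bb′ refl h₁ h₂ = z≤n
extendBad true true false true false true vb ba ab′ b′u ub true true vb′ false refl h₁ h₂ = z≤n
extendBad true true false true false true false ba ab′ b′u ub true true vb′ true refl h₁ h₂ = s≤s z≤n
extendBad true true false true false true true false ab′ b′u ub true true vb′ true refl h₁ h₂ = s≤s z≤n
extendBad true true false true false true true true false b′u ub true true vb′ true refl h₁ h₂ = s≤s z≤n
extendBad true true false true false true true true true false ub true true vb′ true refl h₁ h₂ = s≤s z≤n
extendBad true true false true false true true true true true ub true true vb′ true refl h₁ h₂
  rewrite h₁ refl | h₂ refl = ≤-refl
extendBad false false false sa sb′ true vb ba ab′ b′u ub ua va vb′ bb′ refl h₁ h₂ = z≤n
extendBad false false true true sb′ true vb ba ab′ b′u ub ua va vb′ bb′ refl h₁ h₂ = z≤n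
extendBad false false true false sb′ true vb ba ab′ b′u ub false va vb′ bb′ refl h₁ h₂ = z≤n
extendBad false false true false sb′ true vb ba ab′ b′u ub true false vb′ bb′ refl h₁ h₂ = z≤n
extendBad false false true false false true vb ba ab′ b′u ub true true vb′ bb′ refl h₁ h₂ = z≤n
extendBad false false true false true true vb ba ab′ b′u ub true true vb′ false refl h₁ h₂ = z≤n
extendBad false false true false true true false ba ab′ b′u ub true true vb′ true refl h₁ h₂ = s≤s z≤n
extendBad false false true false true true true false ab′ b′u ub true true vb′ true refl h₁ h₂ = s≤s z≤n
extendBad false false true false true true true true false b′u ub true true vb′ true refl h₁ h₂ = s≤s z≤n
extendBad false false true false true true true true true false ub true true vb′ true refl h₁ h₂ = s≤s z≤n
extendBad false false true false true true true true true true ub true true vb′ true refl h₁ h₂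
  rewrite h₁ refl | h₂ refl = ≤-refl

-- Close the path from a ∈ N(v) to b ∈ N(v) through b′ and a′, where a, a′ lie in the first part
-- and b, b′ in the second.
closePath : ∀ sa sb′ sa′ sb va ab′ b′a′ a′b bv vb′ va′ aa′ ab b′b →
  (sa xor sb ≡ true → ab ≡ true) →
  𝟙 va * 𝟙 sa * 𝟙 (not sb′) * (𝟙 sa′ * (𝟙 bv * 𝟙 (not sb))) ≤
  𝟙 (not ab′ ∧ (sa xor sb′)) + (𝟙 (not b′a′ ∧ (sb′ xor sa′)) + (𝟙 (not a′b ∧ (sa′ xor sb)) +
  (𝟙 (not vb′) + (𝟙 (not va′) + (𝟙 (not aa′) + (𝟙 (not b′b) +
  𝟙 va * 𝟙 ab′ * 𝟙 b′a′ * 𝟙 a′b * 𝟙 bv * (𝟙 vb′ * 𝟙 va′ * 𝟙 aa′ * 𝟙 ab * 𝟙 b′b)))))))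
closePath sa sb′ sa′ sb false ab′ b′a′ a′b bv vb′ va′ aa′ ab b′b h = z≤n
closePath false sb′ sa′ sb true ab′ b′a′ a′b bv vb′ va′ aa′ ab b′b h = z≤n
closePath true true sa′ sb true ab′ b′a′ a′b bv vb′ va′ aa′ ab b′b h = z≤n
closePath true false false sb true ab′ b′a′ a′b bv vb′ va′ aa′ ab b′b h = z≤n
closePath true false true sb true ab′ b′a′ a′b false vb′ va′ aa′ ab b′b h = z≤n
closePath true false true true true ab′ b′a′ a′b true vb′ va′ aa′ ab b′b h = z≤n
closePath true false true false true false b′a′ a′b true vb′ va′ aa′ ab b′b h = s≤s z≤n
closePath true false true false true true false a′b true vb′ va′ aa′ ab b′b h = s≤s z≤n
closePath true false true false true true true false true vb′ va′ aa′ ab b′b h = s≤s z≤n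
closePath true false true false true true true true true false va′ aa′ ab b′b h = s≤s z≤n
closePath true false true false true true true true true true false aa′ ab b′b h = s≤s z≤n
closePath true false true false true true true true true true true false ab b′b h = s≤s z≤n
closePath true false true false true true true true true true true true ab false h = s≤s z≤n
closePath true false true false true true true true true true true true ab true h
  rewrite h refl = ≤-refl

module _ {n : ℕ} (G : Graph n) (s : Fin n → Bool) where
  open Embeddings G
  open Partition G s

  -- `insize u` counts `u` itself, and also `v` if `uv` is bad; these are the two vertices removed.
  insize-ne : ∀ u v → insize u ∸ 2 ≤ ∑ λ a → 𝟙 (same u a) * 𝟙 (ne u a) * 𝟙 (ne v a)
  insize-ne u v = begin
    insize u ∸ 2     ≤⟨ ∸-monoˡ-≤ 2 upper ⟩
    S + 1 + 1 ∸ 2    ≡⟨ cong (_∸ 2) (+-assoc S 1 1) ⟩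
    S + 2 ∸ 2        ≡⟨ m+n∸n≡m S 2 ⟩
    S                ∎
    where
    open ≤-Reasoning
    S = ∑ λ a → 𝟙 (same u a) * 𝟙 (ne u a) * 𝟙 (ne v a)
    pointwise : ∀ x y z → 𝟙 x ≤ 𝟙 x * 𝟙 y * 𝟙 z + 𝟙 (not y) + 𝟙 (not z)
    pointwise false y z = z≤n
    pointwise true false z = s≤s z≤n
    pointwise true true false = s≤s z≤n
    pointwise true true true = s≤s z≤n
    upper : insize u ≤ S + 1 + 1
    upper = begin
      insize u
        ≤⟨ ∑-mono (λ a → pointwise (same u a) (ne u a) (ne v a)) ⟩
      ∑ (λ a → 𝟙 (same u a) * 𝟙 (ne u a) * 𝟙 (ne v a) + 𝟙 (not (ne u a)) + 𝟙 (not (ne v a)))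
        ≡⟨ trans (∑-+ _ _) (cong (_+ ∑ (λ a → 𝟙 (not (ne v a)))) (∑-+ _ _)) ⟩
      S + ∑ (λ a → 𝟙 (not (ne u a))) + ∑ (λ a → 𝟙 (not (ne v a)))
        ≡⟨ cong₂ (λ x y → S + x + y) (∑-eq u) (∑-eq v) ⟩
      S + 1 + 1 ∎

  outsize-ne : ∀ u b → outsize u ∸ 1 ≤ ∑ λ b′ → 𝟙 (opp u b′) * 𝟙 (ne b b′)
  outsize-ne u b = begin
    outsize u ∸ 1  ≤⟨ ∸-monoˡ-≤ 1 upper ⟩
    S + 1 ∸ 1      ≡⟨ m+n∸n≡m S 1 ⟩
    S              ∎
    where
    open ≤-Reasoning
    S = ∑ λ b′ → 𝟙 (opp u b′) * 𝟙 (ne b b′)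
    pointwise : ∀ x y → 𝟙 x ≤ 𝟙 x * 𝟙 y + 𝟙 (not y)
    pointwise false y = z≤n
    pointwise true false = s≤s z≤n
    pointwise true true = s≤s z≤n
    upper : outsize u ≤ S + 1
    upper = begin
      outsize u
        ≤⟨ ∑-mono (λ b′ → pointwise (opp u b′) (ne b b′)) ⟩
      ∑ (λ b′ → 𝟙 (opp u b′) * 𝟙 (ne b b′) + 𝟙 (not (ne b b′)))
        ≡⟨ ∑-+ _ _ ⟩
      S + ∑ (λ b′ → 𝟙 (not (ne b b′)))
        ≡⟨ cong (λ t → S + t) (∑-eq b) ⟩
      S + 1 ∎

  capacity loss : Fin n → ℕ
  capacity u = outsize u * (outsize u ∸ 1) * (insize u ∸ 2)
  loss u = n * (n * misDeg u)

  -- Union bound over the triples b, a, b′ that should complete `uv` to the cycle u v b a b′.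
  -- Coincidences are excluded when the triples are chosen, so only the missing pairs vb, ba, ab′
  -- and b′u can spoil one. A missing pair at `u` or `v` leaves two vertices free and one away from
  -- them leaves a single vertex free, hence n² times a missing degree in one case and n times `M`
  -- in the other.
  capacity≤ : ∀ u v → bad u v ≡ true →
    capacity u ≤ loss v + (n * M + (n * M + (loss u + Σ₃ (cyc₁ u v))))
  capacity≤ u v h = begin
    capacity u
      ≡⟨ commute (outsize u) (outsize u ∸ 1) (insize u ∸ 2) ⟩
    outsize u * (insize u ∸ 2) * (outsize u ∸ 1)
      ≤⟨ *-monoˡ-≤ _ (*-monoʳ-≤ (outsize u) (insize-ne u v)) ⟩
    outsize u * ∑ A * (outsize u ∸ 1)
      ≡⟨ cong (_* (outsize u ∸ 1)) (Σ₂-* _ A) ⟨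
    Σ₂ (λ b a → 𝟙 (opp u b) * A a) * (outsize u ∸ 1)
      ≡⟨ trans (∑-cong λ b → ∑-*ʳ _ _) (∑-*ʳ _ _) ⟨
    Σ₂ (λ b a → 𝟙 (opp u b) * A a * (outsize u ∸ 1))
      ≤⟨ Σ₂-mono (λ b a → *-monoʳ-≤ (𝟙 (opp u b) * A a) (outsize-ne u b)) ⟩
    Σ₂ (λ b a → 𝟙 (opp u b) * A a * ∑ (λ b′ → 𝟙 (opp u b′) * 𝟙 (ne b b′)))
      ≡⟨ Σ₂-cong (λ b a → ∑-*ˡ (𝟙 (opp u b) * A a) _) ⟨
    Σ₃ (λ b a b′ → 𝟙 (opp u b) * A a * (𝟙 (opp u b′) * 𝟙 (ne b b′)))
      ≤⟨ Σ₃-mono (λ b a b′ → extendBad (s u) (s v) (s b) (s a) (s b′)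
           (adj u v) (adj v b) (adj b a) (adj a b′) (adj b′ u)
           (ne u b) (ne u a) (ne v a) (ne v b′) (ne b b′) h
           (separated s u b) (separated s v b′)) ⟩
    Σ₃ (λ b a b′ → 𝟙 (mis v b) + (𝟙 (mis b a) + (𝟙 (mis a b′) + (𝟙 (mis b′ u) + cyc₁ u v b a b′))))
      ≡⟨ Σ₃-+ _ _ ⟩
    _ ≡⟨ cong₂ _+_ loss-v (trans (Σ₃-+ _ _) (cong₂ _+_ loss-M (trans (Σ₃-+ _ _) (cong₂ _+_ (∑-const M)
         (trans (Σ₃-+ _ _) (cong (_+ Σ₃ (cyc₁ u v)) loss-u)))))) ⟩
    loss v + (n * M + (n * M + (loss u + Σ₃ (cyc₁ u v)))) ∎
    where
    open ≤-Reasoning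
    A : Fin n → ℕ
    A a = 𝟙 (same u a) * 𝟙 (ne u a) * 𝟙 (ne v a)
    commute : ∀ o x y → o * x * y ≡ o * y * x
    commute = solve-∀
    loss-v : Σ₃ (λ b a b′ → 𝟙 (mis v b)) ≡ loss v
    loss-v = trans (∑-cong λ b → Σ₂-const (𝟙 (mis v b)))
                   (trans (∑-*ˡ n _) (cong (n *_) (∑-*ˡ n _)))
    loss-M : Σ₃ (λ b a b′ → 𝟙 (mis b a)) ≡ n * M
    loss-M = trans (Σ₂-cong λ b a → ∑-const (𝟙 (mis b a))) (Σ₂-*ˡ n _)
    loss-u : Σ₃ (λ b a b′ → 𝟙 (mis b′ u)) ≡ loss u
    loss-u = trans (Σ₂-const (∑ λ b′ → 𝟙 (mis b′ u)))
                   (cong (λ x → n * (n * x)) (∑-cong λ b′ → cong 𝟙 (mis-sym b′ u)))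

  -- Paths formed by a bad edge and a missing pair with a common end. This is where the maximum bad
  -- degree enters: it bounds `V` by that maximum times `M`, whereas an unrestricted `V` could be
  -- too large to be compensated.
  V : ℕ
  V = ∑ λ u → badDeg u * misDeg u

  Σbad*capacity≤ :
    ∑ (λ u → badDeg u * capacity u) ≤ W + 2 * (n * (n * V) + n * (B * M))
  Σbad*capacity≤ = begin
    ∑ (λ u → badDeg u * capacity u)
      ≡⟨ ∑-cong (λ u → ∑-*ʳ (capacity u) _) ⟨
    Σ₂ (λ u v → 𝟙 (bad u v) * capacity u)
      ≤⟨ Σ₂-mono (λ u v → pointwise u v (bad u v) refl) ⟩
    Σ₂ (λ u v → 𝟙 (bad u v) * loss v + (𝟙 (bad u v) * (n * M + n * M) +
                (𝟙 (bad u v) * loss u + Σ₃ (cyc₁ u v))))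
      ≡⟨ trans (Σ₂-+ _ _) (cong₂ _+_ V₁ (trans (Σ₂-+ _ _) (cong₂ _+_ BM (trans (Σ₂-+ _ _)
           (cong (_+ W) V₂))))) ⟩
    n * (n * V) + (B * (n * M + n * M) + (n * (n * V) + W))
      ≡⟨ collect n V B M W ⟩
    W + 2 * (n * (n * V) + n * (B * M)) ∎
    where
    open ≤-Reasoning
    collect : ∀ n V B M W → n * (n * V) + (B * (n * M + n * M) + (n * (n * V) + W)) ≡
      W + 2 * (n * (n * V) + n * (B * M))
    collect = solve-∀
    pointwise : ∀ u v x → bad u v ≡ x → 𝟙 x * capacity u ≤
      𝟙 x * loss v + (𝟙 x * (n * M + n * M) + (𝟙 x * loss u + Σ₃ (cyc₁ u v)))
    pointwise u v false _ = z≤n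
    pointwise u v true  h = begin
      1 * capacity u
        ≡⟨ *-identityˡ _ ⟩
      capacity u
        ≤⟨ capacity≤ u v h ⟩
      loss v + (n * M + (n * M + (loss u + Σ₃ (cyc₁ u v))))
        ≡⟨ ones (loss v) (n * M) (loss u) _ ⟩
      1 * loss v + (1 * (n * M + n * M) + (1 * loss u + Σ₃ (cyc₁ u v))) ∎
      where
      ones : ∀ a b c d → a + (b + (b + (c + d))) ≡ 1 * a + (1 * (b + b) + (1 * c + d))
      ones = solve-∀
    BM : Σ₂ (λ u v → 𝟙 (bad u v) * (n * M + n * M)) ≡ B * (n * M + n * M)
    BM = trans (∑-cong λ u → ∑-*ʳ _ _) (∑-*ʳ _ _)
    V₂ : Σ₂ (λ u v → 𝟙 (bad u v) * loss u) ≡ n * (n * V)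
    V₂ = trans (∑-cong λ u → trans (∑-*ʳ (loss u) _) (reassoc n (badDeg u) (misDeg u)))
               (trans (∑-*ˡ n _) (cong (n *_) (∑-*ˡ n _)))
      where
      reassoc : ∀ n b m → b * (n * (n * m)) ≡ n * (n * (b * m))
      reassoc = solve-∀
    V₁ : Σ₂ (λ u v → 𝟙 (bad u v) * loss v) ≡ n * (n * V)
    V₁ = trans (Σ₂-swap _) (trans (Σ₂-cong λ v u → cong (λ x → 𝟙 x * loss v) (bad-sym u v)) V₂)

  N₁ N₂ : Fin n → ℕ
  N₁ v = ∑ λ x → 𝟙 (adj v x) * 𝟙 (s x)
  N₂ v = ∑ λ x → 𝟙 (adj v x) * 𝟙 (not (s x))

  -- Union bound over the tuples v a b′ a′ b: each of the three required cross pairs fails for at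
  -- most n²M tuples, and each of four possible coincidences occurs for n³. Unlike in `capacity≤`,
  -- coincidences may be charged as errors here, since only the order of magnitude n⁴ matters.
  N₁*N₂*pr≤ : ∀ v → N₁ v * N₂ v * (p * r) ≤ Σ₄ (cyc v) + (3 * (n * (n * M)) + 4 * (n * (n * n)))
  N₁*N₂*pr≤ v = begin
    N₁ v * N₂ v * (p * r)
      ≡⟨ reorder (N₁ v) (N₂ v) p r ⟩
    (N₁ v * r) * (p * N₂ v)
      ≡⟨ cong₂ _*_ (Σ₂-* _ _) (Σ₂-* _ _) ⟨
    Σ₂ f * Σ₂ g
      ≡⟨ trans (∑-cong λ a → ∑-*ʳ _ _) (∑-*ʳ _ _) ⟨
    Σ₂ (λ a b′ → f a b′ * Σ₂ g)
      ≡⟨ Σ₂-cong (λ a b′ → Σ₂-*ˡ (f a b′) g) ⟨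
    Σ₄ (λ a b′ a′ b → f a b′ * g a′ b)
      ≤⟨ Σ₄-mono (λ a b′ a′ b → ≤-trans
           (≤-reflexive (cong (λ x → f a b′ * (𝟙 (s a′) * (𝟙 x * 𝟙 (not (s b))))) (adj-sym v b)))
           (closePath (s a) (s b′) (s a′) (s b)
           (adj v a) (adj a b′) (adj b′ a′) (adj a′ b) (adj b v)
           (ne v b′) (ne v a′) (ne a a′) (ne a b) (ne b′ b) (separated s a b))) ⟩
    Σ₄ (λ a b′ a′ b → 𝟙 (mis a b′) + (𝟙 (mis b′ a′) + (𝟙 (mis a′ b) +
      (𝟙 (not (ne v b′)) + (𝟙 (not (ne v a′)) + (𝟙 (not (ne a a′)) + (𝟙 (not (ne b′ b)) +
      cyc v a b′ a′ b)))))))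
      ≡⟨ trans (Σ₄-+ _ _) (cong₂ _+_ m₁ (trans (Σ₄-+ _ _) (cong₂ _+_ m₂ (trans (Σ₄-+ _ _) (cong₂ _+_ m₃
        (trans (Σ₄-+ _ _) (cong₂ _+_ e₁ (trans (Σ₄-+ _ _) (cong₂ _+_ e₂ (trans (Σ₄-+ _ _) (cong₂ _+_ e₃
        (trans (Σ₄-+ _ _) (cong (_+ Σ₄ (cyc v)) e₄))))))))))))) ⟩
    n * (n * M) + (n * (n * M) + (n * (n * M) + (n * (n * n) + (n * (n * n) + (n * (n * n) +
      (n * (n * n) + Σ₄ (cyc v)))))))
      ≡⟨ collect (n * (n * M)) (n * (n * n)) (Σ₄ (cyc v)) ⟩
    Σ₄ (cyc v) + (3 * (n * (n * M)) + 4 * (n * (n * n))) ∎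
    where
    open ≤-Reasoning
    f g : Fin n → Fin n → ℕ
    f a b′ = 𝟙 (adj v a) * 𝟙 (s a) * 𝟙 (not (s b′))
    g a′ b = 𝟙 (s a′) * (𝟙 (adj v b) * 𝟙 (not (s b)))
    reorder : ∀ a b p r → a * b * (p * r) ≡ (a * r) * (p * b)
    reorder = solve-∀
    collect : ∀ a b c → a + (a + (a + (b + (b + (b + (b + c)))))) ≡ c + (3 * a + 4 * b)
    collect = solve-∀
    m₁ : Σ₄ (λ a b′ a′ b → 𝟙 (mis a b′)) ≡ n * (n * M)
    m₁ = trans (Σ₂-cong λ a b′ → Σ₂-const (𝟙 (mis a b′))) (trans (Σ₂-*ˡ n _) (cong (n *_) (Σ₂-*ˡ n _)))
    m₂ : Σ₄ (λ a b′ a′ b → 𝟙 (mis b′ a′)) ≡ n * (n * M)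
    m₂ = trans (∑-const _) (cong (n *_) (trans (Σ₂-cong λ b′ a′ → ∑-const (𝟙 (mis b′ a′))) (Σ₂-*ˡ n _)))
    m₃ : Σ₄ (λ a b′ a′ b → 𝟙 (mis a′ b)) ≡ n * (n * M)
    m₃ = Σ₂-const M
    eqs : ∀ w → n * ∑ (λ x → 𝟙 (not (ne w x))) ≡ n
    eqs w = trans (cong (n *_) (∑-eq w)) (*-identityʳ n)
    e₁ : Σ₄ (λ a b′ a′ b → 𝟙 (not (ne v b′))) ≡ n * (n * n)
    e₁ = trans (∑-const _) (cong (n *_) (trans (∑-cong λ b′ → Σ₂-const (𝟙 (not (ne v b′))))
           (trans (∑-*ˡ n _) (cong (n *_) (trans (∑-*ˡ n _) (eqs v))))))
    e₂ : Σ₄ (λ a b′ a′ b → 𝟙 (not (ne v a′))) ≡ n * (n * n)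
    e₂ = trans (Σ₂-const _) (cong (λ x → n * (n * x)) (trans (∑-cong λ a′ → ∑-const (𝟙 (not (ne v a′))))
           (trans (∑-*ˡ n _) (eqs v))))
    e₃ : Σ₄ (λ a b′ a′ b → 𝟙 (not (ne a a′))) ≡ n * (n * n)
    e₃ = trans (∑-cong λ a → trans (∑-const _) (cong (n *_) (trans (∑-cong λ a′ → ∑-const (𝟙 (not (ne a a′))))
           (trans (∑-*ˡ n _) (eqs a))))) (∑-const _)
    e₄ : Σ₄ (λ a b′ a′ b → 𝟙 (not (ne b′ b))) ≡ n * (n * n)
    e₄ = trans (∑-const _) (cong (n *_) (trans (∑-cong λ b′ → trans (∑-const _) (eqs b′)) (∑-const n)))

-- Few five-cycles force few triangles

2ab≤a²+b² : ∀ a b → 2 * (a * b) ≤ a * a + b * b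
2ab≤a²+b² a b with ≤-total a b
... | inj₁ a≤b with k , refl ← m≤n⇒∃[o]m+o≡n a≤b =
  ≤-trans (m≤m+n _ (k * k)) (≤-reflexive (lem a k))
  where
  lem : ∀ a k → 2 * (a * (a + k)) + k * k ≡ a * a + (a + k) * (a + k)
  lem = solve-∀
... | inj₂ b≤a with k , refl ← m≤n⇒∃[o]m+o≡n b≤a =
  ≤-trans (m≤m+n _ (k * k)) (≤-reflexive (lem b k))
  where
  lem : ∀ b k → 2 * ((b + k) * b) + k * k ≡ (b + k) * (b + k) + b * b
  lem = solve-∀

n*[k∸n]≤k*k : ∀ k n → n * (k ∸ n) ≤ k * k
n*[k∸n]≤k*k k n with ≤-total n k
... | inj₁ n≤k = *-mono-≤ n≤k (m∸n≤m k n)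
... | inj₂ k≤n rewrite m≤n⇒m∸n≡0 k≤n | *-zeroʳ n = z≤n

-- Linear in the defects k ∸ x and k ∸ y, so that it can be summed over the edges of a link.
truncated-product : ∀ k x y → k * k ≤ x * y + (k * (k ∸ x) + k * (k ∸ y))
truncated-product k x y with ≤-total x k | ≤-total y k
... | inj₂ k≤x | inj₂ k≤y = ≤-trans (*-mono-≤ k≤x k≤y) (m≤m+n _ _)
... | inj₂ k≤x | inj₁ y≤k with j , refl ← m≤n⇒∃[o]m+o≡n y≤k
  rewrite m≤n⇒m∸n≡0 k≤x | *-zeroʳ (y + j) | m+n∸m≡n y j = begin
  (y + j) * (y + j)         ≡⟨ lem y j ⟩
  (y + j) * y + (y + j) * j ≤⟨ +-monoˡ-≤ _ (*-monoˡ-≤ y k≤x) ⟩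
  x * y + (y + j) * j       ∎
  where
  open ≤-Reasoning
  lem : ∀ y j → (y + j) * (y + j) ≡ (y + j) * y + (y + j) * j
  lem = solve-∀
truncated-product k x y | inj₁ x≤k | inj₂ k≤y with j , refl ← m≤n⇒∃[o]m+o≡n x≤k
  rewrite m≤n⇒m∸n≡0 k≤y | *-zeroʳ (x + j) | m+n∸m≡n x j = begin
  (x + j) * (x + j)               ≡⟨ lem x j ⟩
  x * (x + j) + ((x + j) * j + 0) ≤⟨ +-monoˡ-≤ _ (*-monoʳ-≤ x k≤y) ⟩
  x * y + ((x + j) * j + 0)       ∎
  where
  open ≤-Reasoning
  lem : ∀ x j → (x + j) * (x + j) ≡ x * (x + j) + ((x + j) * j + 0)
  lem = solve-∀
truncated-product k x y | inj₁ x≤k | inj₁ y≤k = begin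
  k * k                       ≡⟨ cong₂ _*_ (m+[n∸m]≡n x≤k) (m+[n∸m]≡n y≤k) ⟨
  (x + i) * (y + j)           ≤⟨ m≤m+n _ (i * j) ⟩
  (x + i) * (y + j) + i * j   ≡⟨ lem x y i j ⟩
  x * y + ((y + j) * i + (x + i) * j)
    ≡⟨ cong₂ (λ a b → x * y + (a * i + b * j)) (m+[n∸m]≡n y≤k) (m+[n∸m]≡n x≤k) ⟩
  x * y + (k * i + k * j)     ∎
  where
  open ≤-Reasoning
  i = k ∸ x
  j = k ∸ y
  lem : ∀ x y i j → (x + i) * (y + j) + i * j ≡ x * y + ((y + j) * i + (x + i) * j)
  lem = solve-∀

module Triangles {n : ℕ} (G : Graph n) where
  open Embeddings G

  link : (w x y : Fin n) → ℕ
  link w x y = 𝟙 (adj w x) * 𝟙 (adj w y) * 𝟙 (adj x y)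

  T : ℕ
  T = Σ₃ link

  hom≤ : ∀ i j k l m → hom i j k l m ≤
    𝟙 (not (ne i k)) + (𝟙 (not (ne i l)) + (𝟙 (not (ne j l)) + (𝟙 (not (ne j m)) +
    (𝟙 (not (ne k m)) + cyc i j k l m))))
  hom≤ i j k l m = go (hom i j k l m) (ne i k) (ne i l) (ne j l) (ne j m) (ne k m)
    (hom≤1 (adj i j) (adj j k) (adj k l) (adj l m) (adj m i))
    where
    hom≤1 : ∀ a b c d e → 𝟙 a * 𝟙 b * 𝟙 c * 𝟙 d * 𝟙 e ≤ 1
    hom≤1 a b c d e = *-mono-≤ (*-mono-≤ (*-mono-≤ (*-mono-≤ (𝟙≤1 a) (𝟙≤1 b)) (𝟙≤1 c)) (𝟙≤1 d)) (𝟙≤1 e)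
    go : ∀ h a b c d e → h ≤ 1 → h ≤ 𝟙 (not a) + (𝟙 (not b) + (𝟙 (not c) + (𝟙 (not d) +
      (𝟙 (not e) + h * (𝟙 a * 𝟙 b * 𝟙 c * 𝟙 d * 𝟙 e)))))
    go h false b c d e h≤1 = ≤-trans h≤1 (s≤s z≤n)
    go h true false c d e h≤1 = ≤-trans h≤1 (s≤s z≤n)
    go h true true false d e h≤1 = ≤-trans h≤1 (s≤s z≤n)
    go h true true true false e h≤1 = ≤-trans h≤1 (s≤s z≤n)
    go h true true true true false h≤1 = ≤-trans h≤1 (s≤s z≤n)
    go h true true true true true h≤1 = ≤-reflexive (sym (*-identityʳ h))

  -- A closed walk of length 5 that is not a cycle identifies two nonconsecutive vertices; there are
  -- five such pairs, with n⁴ tuples each.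
  Σhom≤ : Σ₅ hom ≤ Σ₅ cyc + 5 * (n * (n * (n * n)))
  Σhom≤ = begin
    Σ₅ hom
      ≤⟨ Σ₅-mono hom≤ ⟩
    _ ≡⟨ trans (Σ₅-+ _ _) (cong₂ _+_ ik (trans (Σ₅-+ _ _) (cong₂ _+_ il (trans (Σ₅-+ _ _) (cong₂ _+_ jl
         (trans (Σ₅-+ _ _) (cong₂ _+_ jm (trans (Σ₅-+ _ _) (cong (_+ Σ₅ cyc) km))))))))) ⟩
    n * (n * (n * n)) + (n * (n * (n * n)) + (n * (n * (n * n)) + (n * (n * (n * n)) +
      (n * (n * (n * n)) + Σ₅ cyc))))
      ≡⟨ collect (n * (n * (n * n))) (Σ₅ cyc) ⟩
    Σ₅ cyc + 5 * (n * (n * (n * n))) ∎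
    where
    open ≤-Reasoning
    collect : ∀ a c → a + (a + (a + (a + (a + c)))) ≡ c + 5 * a
    collect = solve-∀
    eq₁ : ∀ u → ∑ (λ v → n * 𝟙 (not (ne u v))) ≡ n
    eq₁ u = trans (∑-*ˡ n _) (trans (cong (n *_) (∑-eq u)) (*-identityʳ n))
    eq₂ : ∀ u → Σ₂ (λ v w → n * 𝟙 (not (ne u w))) ≡ n * n
    eq₂ u = trans (∑-const _) (cong (n *_) (eq₁ u))
    eq₃ : ∀ u → Σ₃ (λ v w x → 𝟙 (not (ne u w))) ≡ n * n
    eq₃ u = trans (Σ₂-cong λ v w → ∑-const _) (eq₂ u)
    eq₄ : ∀ u → Σ₃ (λ v w x → 𝟙 (not (ne u x))) ≡ n * n
    eq₄ u = trans (Σ₂-const _) (cong (n *_) (trans (cong (n *_) (∑-eq u)) (*-identityʳ n)))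
    ik : Σ₅ (λ i j k l m → 𝟙 (not (ne i k))) ≡ n * (n * (n * n))
    ik = trans (∑-cong λ i → trans (∑-const _) (cong (n *_)
           (trans (∑-cong λ k → Σ₂-const _) (trans (∑-*ˡ n _) (cong (n *_) (eq₁ i))))))
           (∑-const _)
    il : Σ₅ (λ i j k l m → 𝟙 (not (ne i l))) ≡ n * (n * (n * n))
    il = trans (∑-cong λ i → trans (∑-const _) (cong (n *_) (eq₃ i))) (∑-const _)
    jl : Σ₅ (λ i j k l m → 𝟙 (not (ne j l))) ≡ n * (n * (n * n))
    jl = trans (∑-const _) (cong (n *_) (trans (∑-cong eq₃) (∑-const _)))
    jm : Σ₅ (λ i j k l m → 𝟙 (not (ne j m))) ≡ n * (n * (n * n))
    jm = trans (∑-const _) (cong (n *_) (trans (∑-cong eq₄) (∑-const _)))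
    km : Σ₅ (λ i j k l m → 𝟙 (not (ne k m))) ≡ n * (n * (n * n))
    km = trans (Σ₂-const _) (cong (λ x → n * (n * x))
           (trans (∑-cong λ k → trans (∑-const _) (trans (cong (n *_) (∑-eq k)) (*-identityʳ n))) (∑-const n)))

  -- The degree of `x` in the graph induced on the neighbourhood of `w`, and 0 if `x` lies outside
  -- it.
  cod : Fin n → Fin n → ℕ
  cod w x = ∑ (link w x)

  -- Walks v₁ x y v₄ in the link of w close up to homomorphic images w v₁ x y v₄ of the 5-cycle.
  Σwalks≤Σhom : Σ₃ (λ w x y → link w x y * (cod w x * cod w y)) ≤ Σ₅ hom
  Σwalks≤Σhom = begin
    Σ₃ (λ w x y → link w x y * (cod w x * cod w y))
      ≡⟨ Σ₃-cong (λ w x y → trans (cong (link w x y *_) (sym (Σ₂-* _ _))) (sym (Σ₂-*ˡ (link w x y) _))) ⟩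
    Σ₅ (λ w x y v₁ v₄ → link w x y * (link w x v₁ * link w y v₄))
      ≤⟨ Σ₅-mono (λ w x y v₁ v₄ → pointwise w x y v₁ v₄) ⟩
    Σ₅ (λ w x y v₁ v₄ → hom w v₁ x y v₄)
      ≡⟨ ∑-cong (λ w → trans (∑-cong λ x → ∑-swap _) (∑-swap _)) ⟩
    Σ₅ hom ∎
    where
    open ≤-Reasoning
    go : ∀ wx wy xy wv xv wu yu → 𝟙 wx * 𝟙 wy * 𝟙 xy * (𝟙 wx * 𝟙 wv * 𝟙 xv * (𝟙 wy * 𝟙 wu * 𝟙 yu)) ≤
      𝟙 wv * 𝟙 xv * 𝟙 xy * 𝟙 yu * 𝟙 wu
    go false wy xy wv xv wu yu = z≤n
    go true false xy wv xv wu yu = z≤n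
    go true true false wv xv wu yu = z≤n
    go true true true false xv wu yu = z≤n
    go true true true true false wu yu = z≤n
    go true true true true true false yu = z≤n
    go true true true true true true false = z≤n
    go true true true true true true true = ≤-refl
    pointwise : ∀ w x y v₁ v₄ → link w x y * (link w x v₁ * link w y v₄) ≤ hom w v₁ x y v₄
    pointwise w x y v₁ v₄ rewrite adj-sym v₁ x | adj-sym v₄ w =
      go (adj w x) (adj w y) (adj x y) (adj w v₁) (adj x v₁) (adj w v₄) (adj y v₄)

  -- An edge `xy` of the link of `w` is the middle of `cod w x * cod w y` walks of length 3. This is
  -- at least k² when both degrees reach `k`, and otherwise `truncated-product` charges the
  -- shortfall to the ends. Since `x` has `cod w x` edges in the link, its total charge is k · cod ·
  -- (k - cod), which is at most k³, for each of the n² pairs `w`, `x`.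
  triangles≤ : ∀ k → k * k * T ≤
    Σ₅ cyc + 5 * (n * (n * (n * n))) + 2 * (n * (n * (k * (k * k))))
  triangles≤ k = begin
    k * k * T
      ≡⟨ Σ₃-*ˡ (k * k) link ⟨
    Σ₃ (λ w x y → k * k * link w x y)
      ≤⟨ Σ₃-mono (λ w x y → pointwise w x y) ⟩
    Σ₃ (λ w x y → link w x y * (cod w x * cod w y) + (defect w x y + defect w y x))
      ≡⟨ trans (Σ₃-+ _ _) (cong (λ t → walks + t) (Σ₃-+ _ _)) ⟩
    walks + (Σ₃ defect + Σ₃ (λ w x y → defect w y x))
      ≡⟨ cong (λ z → walks + (Σ₃ defect + z)) (∑-cong λ w → Σ₂-swap _) ⟩
    walks + (Σ₃ defect + Σ₃ defect)
      ≤⟨ +-mono-≤ (≤-trans Σwalks≤Σhom Σhom≤) (+-mono-≤ small small) ⟩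
    Σ₅ cyc + 5 * (n * (n * (n * n))) + (n * (n * (k * (k * k))) + n * (n * (k * (k * k))))
      ≡⟨ cong (λ t → Σ₅ cyc + 5 * (n * (n * (n * n))) + (n * (n * (k * (k * k))) + t)) (+-identityʳ _) ⟨
    Σ₅ cyc + 5 * (n * (n * (n * n))) + 2 * (n * (n * (k * (k * k)))) ∎
    where
    open ≤-Reasoning
    walks : ℕ
    walks = Σ₃ λ w x y → link w x y * (cod w x * cod w y)
    defect : (w x y : Fin n) → ℕ
    defect w x y = link w x y * (k * (k ∸ cod w x))
    link-sym : ∀ w x y → link w x y ≡ link w y x
    link-sym w x y = cong₂ _*_ (*-comm (𝟙 (adj w x)) (𝟙 (adj w y))) (cong 𝟙 (adj-sym x y))
    pointwise : ∀ w x y →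
      k * k * link w x y ≤ link w x y * (cod w x * cod w y) + (defect w x y + defect w y x)
    pointwise w x y rewrite link-sym w y x = begin
      k * k * link w x y
        ≡⟨ *-comm (k * k) (link w x y) ⟩
      link w x y * (k * k)
        ≤⟨ *-monoʳ-≤ (link w x y) (truncated-product k (cod w x) (cod w y)) ⟩
      link w x y * (cod w x * cod w y + (k * (k ∸ cod w x) + k * (k ∸ cod w y)))
        ≡⟨ distrib (link w x y) _ _ _ ⟩
      _ ∎
      where
      distrib : ∀ l a b c → l * (a + (b + c)) ≡ l * a + (l * b + l * c)
      distrib = solve-∀
    small : Σ₃ defect ≤ n * (n * (k * (k * k)))
    small = ∑-bound λ w → ∑-bound λ x → begin
      ∑ (λ y → link w x y * (k * (k ∸ cod w x)))  ≡⟨ ∑-*ʳ _ _ ⟩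
      cod w x * (k * (k ∸ cod w x))               ≡⟨ swap (cod w x) k _ ⟩
      k * (cod w x * (k ∸ cod w x))               ≤⟨ *-monoʳ-≤ k (n*[k∸n]≤k*k k (cod w x)) ⟩
      k * (k * k)                                 ∎
      where
      swap : ∀ a b c → a * (b * c) ≡ b * (a * c)
      swap = solve-∀

  badAround : Fin n → ℕ
  badAround x = Partition.B G (adj x)

  -- An edge `uv` is bad for the partition at `x` if `x` is adjacent to both ends or to neither,
  -- which has indicator 1 - [xu] - [xv] + 2[xu][xv]. Summing over `x` and over edges gives n · E -
  -- 2 · DD + 2 · T, with `DD` the sum of squared degrees. The first two terms together are at most
  -- 0 by the Cauchy-Schwarz inequality, because the average degree is at least n/2.
  ΣbadAround≤2T : n * n ≤ 2 * E → ∑ badAround ≤ 2 * T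
  ΣbadAround≤2T n²≤2E = +-cancelʳ-≤ (n * E) _ _ (begin
    ∑ badAround + n * E
      ≤⟨ +-monoʳ-≤ (∑ badAround) nE≤2DD ⟩
    ∑ badAround + 2 * DD
      ≡⟨ identity ⟩
    n * E + 2 * T
      ≡⟨ +-comm (n * E) (2 * T) ⟩
    2 * T + n * E ∎)
    where
    open ≤-Reasoning
    deg : Fin n → ℕ
    deg u = ∑ λ v → 𝟙 (adj u v)
    DD : ℕ
    DD = ∑ λ u → deg u * deg u
    -- The square of the degree is bounded below by its tangent at n/2, which avoids dividing by
    -- `n`.
    tangent : 4 * (n * E) ≤ 4 * DD + n * (n * n)
    tangent = begin
      4 * (n * E)
        ≡⟨ *-assoc 4 n E ⟨
      4 * n * E
        ≡⟨ ∑-*ˡ (4 * n) deg ⟨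
      ∑ (λ u → 4 * n * deg u)
        ≤⟨ ∑-mono (λ u → ≤-trans (≤-reflexive (l₁ n (deg u)))
             (≤-trans (2ab≤a²+b² (2 * deg u) n) (≤-reflexive (l₂ n (deg u))))) ⟩
      ∑ (λ u → 4 * (deg u * deg u) + n * n)
        ≡⟨ trans (∑-+ _ _) (cong₂ _+_ (∑-*ˡ 4 _) (∑-const (n * n))) ⟩
      4 * DD + n * (n * n) ∎
      where
      l₁ : ∀ n d → 4 * n * d ≡ 2 * (2 * d * n)
      l₁ = solve-∀
      l₂ : ∀ n d → 2 * d * (2 * d) + n * n ≡ 4 * (d * d) + n * n
      l₂ = solve-∀
    nE≤2DD : n * E ≤ 2 * DD
    nE≤2DD = *-cancelˡ-≤ 2 (+-cancelʳ-≤ (2 * (n * E)) _ _ (begin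
      2 * (n * E) + 2 * (n * E)  ≡⟨ l₁ (n * E) ⟩
      4 * (n * E)                ≤⟨ tangent ⟩
      4 * DD + n * (n * n)       ≤⟨ +-monoʳ-≤ (4 * DD) (*-monoʳ-≤ n n²≤2E) ⟩
      4 * DD + n * (2 * E)       ≡⟨ l₂ n E DD ⟩
      2 * (2 * DD) + 2 * (n * E) ∎))
      where
      l₁ : ∀ x → 2 * x + 2 * x ≡ 4 * x
      l₁ = solve-∀
      l₂ : ∀ n E D → 4 * D + n * (2 * E) ≡ 2 * (2 * D) + 2 * (n * E)
      l₂ = solve-∀
    pointwise : ∀ a b c → 𝟙 (a ∧ not (b xor c)) + (𝟙 b * 𝟙 a + 𝟙 c * 𝟙 a) ≡
      𝟙 a + 2 * (𝟙 b * 𝟙 c * 𝟙 a)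
    pointwise true  true  true  = refl
    pointwise true  true  false = refl
    pointwise true  false true  = refl
    pointwise true  false false = refl
    pointwise false true  true  = refl
    pointwise false true  false = refl
    pointwise false false true  = refl
    pointwise false false false = refl
    squares : Σ₃ (λ x u v → 𝟙 (adj x u) * 𝟙 (adj u v)) ≡ DD
    squares = trans (Σ₂-cong λ x u → ∑-*ˡ (𝟙 (adj x u)) _)
      (trans (Σ₂-swap _) (trans (Σ₂-cong λ u x → cong (λ b → 𝟙 b * deg u) (adj-sym x u))
      (∑-cong λ u → ∑-*ʳ (deg u) _)))
    squares′ : Σ₃ (λ x u v → 𝟙 (adj x v) * 𝟙 (adj u v)) ≡ DD
    squares′ = trans (∑-cong λ x → trans (Σ₂-swap _)
      (Σ₂-cong λ v u → cong (λ b → 𝟙 (adj x v) * 𝟙 b) (adj-sym u v))) squares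
    identity : ∑ badAround + 2 * DD ≡ n * E + 2 * T
    identity = begin-equality
      ∑ badAround + 2 * DD
        ≡⟨ cong (λ z → ∑ badAround + (DD + z)) (+-identityʳ DD) ⟩
      ∑ badAround + (DD + DD)
        ≡⟨ cong (λ t → ∑ badAround + t) (cong₂ _+_ squares squares′) ⟨
      _ ≡⟨ trans (Σ₃-+ _ _) (cong (λ t → ∑ badAround + t) (Σ₃-+ _ _)) ⟨
      Σ₃ (λ x u v → 𝟙 (Partition.bad G (adj x) u v) +
                    (𝟙 (adj x u) * 𝟙 (adj u v) + 𝟙 (adj x v) * 𝟙 (adj u v)))
        ≡⟨ Σ₃-cong (λ x u v → pointwise (adj u v) (adj x u) (adj x v)) ⟩
      Σ₃ (λ x u v → 𝟙 (adj u v) + 2 * link x u v)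
        ≡⟨ trans (Σ₃-+ _ _) (cong₂ _+_ (∑-const E) (Σ₃-*ˡ 2 link)) ⟩
      n * E + 2 * T ∎

  sparseNeighbourhood : .{{_ : NonZero n}} → n * n ≤ 2 * E → ∃ λ x → n * badAround x ≤ 2 * T
  sparseNeighbourhood n²≤2E with x , h ← pigeonhole badAround = x , ≤-trans h (ΣbadAround≤2T n²≤2E)

-- Making all bad degrees small

module _ {n : ℕ} (G : Graph n) (s : Fin n → Bool) where
  open Embeddings G
  open Partition G s

  4pr≤n² : 4 * (p * r) ≤ n * n
  4pr≤n² = begin
    4 * (p * r)                     ≡⟨ l₁ p r ⟩
    2 * (p * r) + 2 * (p * r)       ≤⟨ +-monoʳ-≤ (2 * (p * r)) (2ab≤a²+b² p r) ⟩
    2 * (p * r) + (p * p + r * r)   ≡⟨ l₂ p r ⟩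
    (p + r) * (p + r)               ≡⟨ cong₂ _*_ p+r≡n p+r≡n ⟩
    n * n                           ∎
    where
    open ≤-Reasoning
    l₁ : ∀ p r → 4 * (p * r) ≡ 2 * (p * r) + 2 * (p * r)
    l₁ = solve-∀
    l₂ : ∀ p r → 2 * (p * r) + (p * p + r * r) ≡ (p + r) * (p + r)
    l₂ = solve-∀

  M≤B : n * n ≤ 2 * E → M ≤ B
  M≤B n²≤2E = *-cancelˡ-≤ 2 (+-cancelˡ-≤ (2 * E) _ _ (begin
    2 * E + 2 * M            ≡⟨ *-distribˡ-+ 2 E M ⟨
    2 * (E + M)              ≡⟨ cong (2 *_) E+M≡2pr+B ⟩
    2 * (2 * (p * r) + B)    ≡⟨ l₁ (p * r) B ⟩
    4 * (p * r) + 2 * B      ≤⟨ +-monoˡ-≤ (2 * B) (≤-trans 4pr≤n² n²≤2E) ⟩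
    2 * E + 2 * B            ∎))
    where
    open ≤-Reasoning
    l₁ : ∀ x B → 2 * (2 * x + B) ≡ 4 * x + 2 * B
    l₁ = solve-∀

  n²≤8pr : n * n ≤ 2 * E → 4 * B ≤ n * n → n * n ≤ 8 * (p * r)
  n²≤8pr n²≤2E 4B≤n² = +-cancelʳ-≤ (n * n) _ _ (begin
    n * n + n * n                  ≤⟨ +-mono-≤ n²≤2E n²≤2E ⟩
    2 * E + 2 * E                  ≡⟨ l₁ E ⟩
    4 * E                          ≤⟨ *-monoʳ-≤ 4 (m≤m+n E M) ⟩
    4 * (E + M)                    ≡⟨ cong (4 *_) E+M≡2pr+B ⟩
    4 * (2 * (p * r) + B)          ≡⟨ l₂ (p * r) B ⟩
    8 * (p * r) + 4 * B            ≤⟨ +-monoʳ-≤ (8 * (p * r)) 4B≤n² ⟩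
    8 * (p * r) + n * n            ∎)
    where
    open ≤-Reasoning
    l₁ : ∀ E → 2 * E + 2 * E ≡ 4 * E
    l₁ = solve-∀
    l₂ : ∀ x B → 4 * (2 * x + B) ≡ 8 * x + 4 * B
    l₂ = solve-∀

  -- If both neighbourhoods exceed n/P, then with pr at least n²/8 the left side of `N₁*N₂*pr≤`,
  -- multiplied by Q = 16 · 8 · P², is at least 16n⁴. The right side multiplied by `Q` is at most (1
  -- + 3 + 4)n⁴: one n⁴ from the cycles, three from the missing pairs and four from the
  -- coincidences.
  one-sided : ∀ {P Q} .{{_ : NonZero n}} → Q ≡ 128 * (P * P) → Q * Σ₅ cyc ≤ n * (n * (n * n)) →
    Q * M ≤ n * n → Q ≤ n → n * n ≤ 8 * (p * r) →
    ∀ v → n < P * N₁ G s v → P * N₂ G s v ≤ n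
  one-sided {P} {Q} refl cycs mism Q≤n n²≤8pr v n<PN₁ = ≮⇒≥ λ n<PN₂ → <⇒≱ 8n⁴<16n⁴ (begin
    16 * n⁴
      ≡⟨ l₁ n ⟩
    16 * ((n * n) * (n * n))
      ≤⟨ *-monoʳ-≤ 16 (*-mono-≤ (*-mono-≤ (<⇒≤ n<PN₁) (<⇒≤ n<PN₂)) n²≤8pr) ⟩
    16 * ((P * N₁′) * (P * N₂′) * (8 * (p * r)))
      ≡⟨ l₂ P N₁′ N₂′ (p * r) ⟩
    Q * (N₁′ * N₂′ * (p * r))
      ≤⟨ *-monoʳ-≤ Q (N₁*N₂*pr≤ G s v) ⟩
    Q * (Σ₄ (cyc v) + (3 * (n * (n * M)) + 4 * (n * (n * n))))
      ≡⟨ l₃ Q n M (Σ₄ (cyc v)) ⟩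
    Q * Σ₄ (cyc v) + (3 * (n * (n * (Q * M))) + 4 * (Q * (n * (n * n))))
      ≤⟨ +-mono-≤ (≤-trans (*-monoʳ-≤ Q (term≤∑ (λ u → Σ₄ (cyc u)) v)) cycs)
         (+-mono-≤ (*-monoʳ-≤ 3 (*-monoʳ-≤ n (*-monoʳ-≤ n mism))) (*-monoʳ-≤ 4 (*-monoˡ-≤ (n * (n * n)) Q≤n))) ⟩
    n⁴ + (3 * n⁴ + 4 * n⁴)
      ≡⟨ l₄ n⁴ ⟩
    8 * n⁴ ∎)
    where
    open ≤-Reasoning
    n⁴ N₁′ N₂′ : ℕ
    n⁴ = n * (n * (n * n))
    N₁′ = N₁ G s v
    N₂′ = N₂ G s v
    instance
      n⁴≢0 : NonZero n⁴
      n⁴≢0 = let instance n²≢0 = m*n≢0 n n ; n³≢0 = m*n≢0 n (n * n) in m*n≢0 n (n * (n * n))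
    8n⁴<16n⁴ : 8 * n⁴ < 16 * n⁴
    8n⁴<16n⁴ = *-monoˡ-< n⁴ (m≤m+n 9 7)
    l₁ : ∀ n → 16 * (n * (n * (n * n))) ≡ 16 * ((n * n) * (n * n))
    l₁ = solve-∀
    l₂ : ∀ P a b x → 16 * ((P * a) * (P * b) * (8 * x)) ≡ 128 * (P * P) * (a * b * x)
    l₂ = solve-∀
    l₃ : ∀ Q n M c → Q * (c + (3 * (n * (n * M)) + 4 * (n * (n * n)))) ≡
      Q * c + (3 * (n * (n * (Q * M))) + 4 * (Q * (n * (n * n))))
    l₃ = solve-∀
    l₄ : ∀ x → x + (3 * x + 4 * x) ≡ 8 * x
    l₄ = solve-∀

  -- Moving every vertex to a part in which it has few neighbours makes all bad degrees small; few
  -- vertices move, because a moved vertex has large bad degree or large missing degree.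
  module Reassign (P : ℕ) where

    s′ : Fin n → Bool
    s′ v = does (P * N₁ G s v ≤? n)

    s′-true : ∀ v → s′ v ≡ true → P * N₁ G s v ≤ n
    s′-true v = witness (P * N₁ G s v ≤? n)

    s′-false : ∀ v → s′ v ≡ false → n < P * N₁ G s v
    s′-false v h = ≰⇒> (refutation (P * N₁ G s v ≤? n) h)

    moved : ℕ
    moved = ∑ λ x → 𝟙 (s x xor s′ x)

    -- A vertex that leaves the first part has more than n/P neighbours there, all of them bad. A
    -- vertex that enters it has at most n/P neighbours among at least 2n/P vertices, and the
    -- remaining ones form missing pairs with it.
    moved-defect : 2 * n ≤ P * p → ∀ x → n * 𝟙 (s x xor s′ x) ≤ P * (badDeg x + misDeg x)
    moved-defect 2n≤Pp x = go (s x) (s′ x) refl refl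
      where
      open ≤-Reasoning
      go : ∀ b b′ → s x ≡ b → s′ x ≡ b′ → n * 𝟙 (b xor b′) ≤ P * (badDeg x + misDeg x)
      go true  true  _ _ = ≤-trans (≤-reflexive (*-zeroʳ n)) z≤n
      go false false _ _ = ≤-trans (≤-reflexive (*-zeroʳ n)) z≤n
      go true  false h h′ = begin
        n * 1                    ≡⟨ *-identityʳ n ⟩
        n                        ≤⟨ <⇒≤ (s′-false x h′) ⟩
        P * N₁ G s x             ≤⟨ *-monoʳ-≤ P (≤-trans
                                      (≤-reflexive (∑-cong λ y → bad≡ (adj x y) (s x) (s y) h))
                                      (m≤m+n _ _)) ⟩
        P * (badDeg x + misDeg x) ∎
        where
        bad≡ : ∀ a t y → t ≡ true → 𝟙 a * 𝟙 y ≡ 𝟙 (a ∧ not (t xor y))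
        bad≡ true  true true  _ = refl
        bad≡ true  true false _ = refl
        bad≡ false true y     _ = refl
      go false true  h h′ = +-cancelʳ-≤ n _ _ (begin
        n * 1 + n                      ≡⟨ l n ⟩
        2 * n                          ≤⟨ 2n≤Pp ⟩
        P * p                          ≡⟨ cong (P *_) (∑-cong λ y → split (adj x y) (s x) (s y) h) ⟩
        _                              ≡⟨ cong (P *_) (∑-+ _ _) ⟩
        P * (misDeg x + N₁ G s x)      ≡⟨ *-distribˡ-+ P (misDeg x) _ ⟩
        P * misDeg x + P * N₁ G s x    ≤⟨ +-mono-≤ (*-monoʳ-≤ P (m≤n+m _ (badDeg x))) (s′-true x h′) ⟩
        P * (badDeg x + misDeg x) + n  ∎)
        where
        l : ∀ n → n * 1 + n ≡ 2 * n
        l = solve-∀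
        split : ∀ a t y → t ≡ false → 𝟙 y ≡ 𝟙 (not a ∧ (t xor y)) + 𝟙 a * 𝟙 y
        split true  false true  _ = refl
        split true  false false _ = refl
        split false false true  _ = refl
        split false false false _ = refl

    P*moved≤n : .{{_ : NonZero n}} → 2 * n ≤ P * p → P * P * (B + M) ≤ n * n → P * moved ≤ n
    P*moved≤n 2n≤Pp few = *-cancelˡ-≤ n (begin
      n * (P * moved)
        ≡⟨ l n P moved ⟩
      P * (n * moved)
        ≡⟨ cong (P *_) (∑-*ˡ n _) ⟨
      P * ∑ (λ x → n * 𝟙 (s x xor s′ x))
        ≤⟨ *-monoʳ-≤ P (∑-mono (moved-defect 2n≤Pp)) ⟩
      P * ∑ (λ x → P * (badDeg x + misDeg x))
        ≡⟨ cong (P *_) (trans (∑-*ˡ P _) (cong (P *_) (∑-+ _ _))) ⟩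
      P * (P * (B + M))
        ≡⟨ *-assoc P P (B + M) ⟨
      P * P * (B + M)
        ≤⟨ few ⟩
      n * n ∎)
      where
      open ≤-Reasoning
      l : ∀ n P m → n * (P * m) ≡ P * (n * m)
      l = solve-∀

    -- A bad neighbour under `s′` either was already in the corresponding old part or has been
    -- moved. The former number at most n/P, by the threshold defining `s′` for the first part and
    -- by `one-sided` for the second; the moved vertices number at most n/P in all.
    P*badDeg≤2n : .{{_ : NonZero n}} → (∀ v → n < P * N₁ G s v → P * N₂ G s v ≤ n) →
      2 * n ≤ P * p → P * P * (B + M) ≤ n * n → ∀ v → P * Partition.badDeg G s′ v ≤ 2 * n
    P*badDeg≤2n one-sided 2n≤Pp few v = go (s′ v) refl
      where
      open ≤-Reasoning
      bound : ∀ {f : Fin n → ℕ} → (∀ x → 𝟙 (Partition.bad G s′ v x) ≤ f x + 𝟙 (s x xor s′ x)) →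
        P * ∑ f ≤ n → P * Partition.badDeg G s′ v ≤ 2 * n
      bound {f} h small = begin
        P * Partition.badDeg G s′ v
          ≤⟨ *-monoʳ-≤ P (≤-trans (∑-mono h) (≤-reflexive (∑-+ _ _))) ⟩
        P * (∑ f + moved)
          ≡⟨ *-distribˡ-+ P (∑ f) moved ⟩
        P * ∑ f + P * moved
          ≤⟨ +-mono-≤ small (P*moved≤n 2n≤Pp few) ⟩
        n + n
          ≡⟨ cong (λ t → n + t) (+-identityʳ n) ⟨
        2 * n ∎
      go : ∀ b → s′ v ≡ b → P * Partition.badDeg G s′ v ≤ 2 * n
      go true  h = bound (λ x → near (adj v x) (s′ v) (s x) (s′ x) h) (s′-true v h)
        where
        near : ∀ a t y y′ → t ≡ true → 𝟙 (a ∧ not (t xor y′)) ≤ 𝟙 a * 𝟙 y + 𝟙 (y xor y′)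
        near false true y     y′    _ = z≤n
        near true  true true  true  _ = ≤-refl
        near true  true true  false _ = z≤n
        near true  true false true  _ = ≤-refl
        near true  true false false _ = z≤n
      go false h = bound (λ x → near (adj v x) (s′ v) (s x) (s′ x) h) (one-sided v (s′-false v h))
        where
        near : ∀ a t y y′ → t ≡ false → 𝟙 (a ∧ not (t xor y′)) ≤ 𝟙 a * 𝟙 (not y) + 𝟙 (y xor y′)
        near false false y     y′    _ = z≤n
        near true  false true  true  _ = z≤n
        near true  false true  false _ = ≤-refl
        near true  false false true  _ = z≤n
        near true  false false false _ = ≤-refl

-- Unbalanced partitions

⌈n/2⌉≡⌊n/2⌋⊎suc : ∀ n → ⌈ n /2⌉ ≡ ⌊ n /2⌋ ⊎ ⌈ n /2⌉ ≡ suc ⌊ n /2⌋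
⌈n/2⌉≡⌊n/2⌋⊎suc zero = inj₁ refl
⌈n/2⌉≡⌊n/2⌋⊎suc (suc zero) = inj₂ refl
⌈n/2⌉≡⌊n/2⌋⊎suc (suc (suc n)) with ⌈n/2⌉≡⌊n/2⌋⊎suc n
... | inj₁ eq = inj₁ (cong suc eq)
... | inj₂ eq = inj₂ (cong suc eq)

n²≡4kh⊎suc : ∀ n → n * n ≡ 4 * (⌊ n /2⌋ * ⌈ n /2⌉) ⊎ n * n ≡ suc (4 * (⌊ n /2⌋ * ⌈ n /2⌉))
n²≡4kh⊎suc n with ⌊ n /2⌋ | ⌈ n /2⌉ | ⌊n/2⌋+⌈n/2⌉≡n n | ⌈n/2⌉≡⌊n/2⌋⊎suc n
... | k | _ | refl | inj₁ refl = inj₁ (lem k)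
  where
  lem : ∀ k → (k + k) * (k + k) ≡ 4 * (k * k)
  lem = solve-∀
... | k | _ | refl | inj₂ refl = inj₂ (lem k)
  where
  lem : ∀ k → (k + suc k) * (k + suc k) ≡ suc (4 * (k * suc k))
  lem = solve-∀

n²/4≡kh : ∀ n → (n ^ 2) / 4 ≡ ⌊ n /2⌋ * ⌈ n /2⌉
n²/4≡kh n rewrite *-identityʳ n with n²≡4kh⊎suc n
... | inj₁ eq rewrite eq | *-comm 4 (⌊ n /2⌋ * ⌈ n /2⌉) = m*n/n≡m (⌊ n /2⌋ * ⌈ n /2⌉) 4
... | inj₂ eq rewrite eq | *-comm 4 (⌊ n /2⌋ * ⌈ n /2⌉) =
  trans (+-distrib-/-∣ʳ 1 {d = 4} (divides-refl (⌊ n /2⌋ * ⌈ n /2⌉))) (m*n/n≡m (⌊ n /2⌋ * ⌈ n /2⌉) 4)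

module _ {q k h O S δ : ℕ} (O+S≡k+h : O + S ≡ k + h) (OS+δ≡kh : O * S + δ ≡ k * h) where

  private
    open ≤-Reasoning

    -- Here h = S + y and δ = y(k - S). If y ≤ δ, the amount qy that the factor S - 2 lacks is made
    -- up by δ(S - 2), as q ≤ S - 2. The inequality y ≤ δ can fail only for odd n with S = k and y =
    -- 1. Then δ = 0, and the claim reduces to (k - 1)² ≤ (k + 1)(k - 2), which is the condition k ≥
    -- 3.
    O≥k : ∀ y → k + y ≡ O → h ≡ k ⊎ h ≡ suc k → 3 ≤ k → 2 ≤ S → q ≤ S ∸ 2 →
      q * k * (k ∸ 1) * (h ∸ 2) ≤ (δ + q) * (O * (O ∸ 1) * (S ∸ 2))
    O≥k y refl h-cases 3≤k 2≤S q≤S-2 = go h-cases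
      where
      h≡S+y : h ≡ S + y
      h≡S+y = +-cancelˡ-≡ k _ _ (trans (sym O+S≡k+h) (l k y S))
        where
        l : ∀ k y S → k + y + S ≡ k + (S + y)
        l = solve-∀
      yS+δ≡yk : y * S + δ ≡ y * k
      yS+δ≡yk = +-cancelˡ-≡ (k * S) _ _ (trans (l₁ k y S δ) (trans OS+δ≡kh (trans (cong (k *_) h≡S+y) (l₂ k S y))))
        where
        l₁ : ∀ k y S δ → k * S + (y * S + δ) ≡ (k + y) * S + δ
        l₁ = solve-∀
        l₂ : ∀ k S y → k * (S + y) ≡ k * S + y * k
        l₂ = solve-∀
      wide : y ≤ δ → q * k * (k ∸ 1) * (h ∸ 2) ≤ (δ + q) * (O * (O ∸ 1) * (S ∸ 2))
      wide y≤δ = begin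
        q * k * (k ∸ 1) * (h ∸ 2)
          ≡⟨ cong (λ z → q * k * (k ∸ 1) * (z ∸ 2)) h≡S+y ⟩
        q * k * (k ∸ 1) * (S + y ∸ 2)
          ≡⟨ cong (q * k * (k ∸ 1) *_) (trans (cong (_∸ 2) (+-comm S y)) (+-∸-assoc y 2≤S)) ⟩
        q * k * (k ∸ 1) * (y + (S ∸ 2))
          ≡⟨ l₁ q k (k ∸ 1) y (S ∸ 2) ⟩
        (k * (k ∸ 1)) * (q * y + q * (S ∸ 2))
          ≤⟨ *-mono-≤ (*-mono-≤ (m≤m+n k y) (∸-monoˡ-≤ 1 (m≤m+n k y)))
               (+-monoˡ-≤ (q * (S ∸ 2)) (*-mono-≤ q≤S-2 y≤δ)) ⟩
        (O * (O ∸ 1)) * ((S ∸ 2) * δ + q * (S ∸ 2))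
          ≡⟨ l₂ O (O ∸ 1) (S ∸ 2) δ q ⟩
        (δ + q) * (O * (O ∸ 1) * (S ∸ 2)) ∎
        where
        l₁ : ∀ q k k′ y s → q * k * k′ * (y + s) ≡ (k * k′) * (q * y + q * s)
        l₁ = solve-∀
        l₂ : ∀ O O′ s δ q → (O * O′) * (s * δ + q * s) ≡ (δ + q) * (O * O′ * s)
        l₂ = solve-∀
      k>S : S < k → y ≤ δ
      k>S S<k = +-cancelˡ-≤ (y * S) _ _ (begin
        y * S + y    ≡⟨ l y S ⟩
        y * suc S    ≤⟨ *-monoʳ-≤ y S<k ⟩
        y * k        ≡⟨ yS+δ≡yk ⟨
        y * S + δ    ∎)
        where
        l : ∀ y S → y * S + y ≡ y * suc S
        l = solve-∀
      -- For odd n both orientations of the balanced partition have δ = 0.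
      swapped : ∀ j k S y → k ≡ 3 + j → S ≡ k → y ≡ 1 →
        k * (k ∸ 1) * (k ∸ 1) ≤ (k + y) * (k + y ∸ 1) * (S ∸ 2)
      swapped j _ _ _ refl refl refl = begin
        (3 + j) * (2 + j) * (2 + j)             ≤⟨ m≤m+n _ _ ⟩
        (3 + j) * (2 + j) * (2 + j) + (3 + j) * j ≡⟨ l j ⟩
        (3 + j + 1) * (2 + j + 1) * (1 + j)     ∎
        where
        l : ∀ j → (3 + j) * (2 + j) * (2 + j) + (3 + j) * j ≡ (3 + j + 1) * (2 + j + 1) * (1 + j)
        l = solve-∀
      go : h ≡ k ⊎ h ≡ suc k → q * k * (k ∸ 1) * (h ∸ 2) ≤ (δ + q) * (O * (O ∸ 1) * (S ∸ 2))
      go (inj₁ h≡k) = by-y y refl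
        where
        by-y : ∀ z → y ≡ z → q * k * (k ∸ 1) * (h ∸ 2) ≤ (δ + q) * (O * (O ∸ 1) * (S ∸ 2))
        by-y zero    refl = wide z≤n
        by-y (suc z) refl = wide (k>S (≤-trans (≤-reflexive (+-comm 1 S))
          (≤-trans (+-monoʳ-≤ S (s≤s z≤n)) (≤-reflexive (trans (sym h≡S+y) h≡k)))))
      go (inj₂ h≡1+k) = by-y y refl
        where
        by-y : ∀ z → y ≡ z → q * k * (k ∸ 1) * (h ∸ 2) ≤ (δ + q) * (O * (O ∸ 1) * (S ∸ 2))
        by-y zero refl = wide z≤n
        by-y (suc (suc z)) refl = wide (k>S (s≤s⁻¹ (≤-trans (≤-reflexive (+-comm 2 S))
          (≤-trans (+-monoʳ-≤ S (s≤s (s≤s z≤n))) (≤-reflexive (trans (sym h≡S+y) h≡1+k))))))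
        by-y (suc zero) refl with j , 3+j≡k ← m≤n⇒∃[o]m+o≡n 3≤k = begin
          q * k * (k ∸ 1) * (h ∸ 2)
            ≡⟨ cong (λ z → q * k * (k ∸ 1) * (z ∸ 2)) h≡1+k ⟩
          q * k * (k ∸ 1) * (k ∸ 1)
            ≡⟨ l q k (k ∸ 1) ⟩
          q * (k * (k ∸ 1) * (k ∸ 1))
            ≤⟨ *-mono-≤ (m≤n+m q δ) (swapped j k S 1 (sym 3+j≡k) S≡k refl) ⟩
          (δ + q) * (O * (O ∸ 1) * (S ∸ 2)) ∎
          where
          l : ∀ q k k′ → q * k * k′ * k′ ≡ q * (k * k′ * k′)
          l = solve-∀
          S≡k : S ≡ k
          S≡k = suc-injective (trans (+-comm 1 S) (trans (sym h≡S+y) h≡1+k))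

    -- Now S = h + y and δ = y(h - O), so that δ ≥ y² ≥ y. Replacing k(k - 1) by O(O - 1) loses at
    -- most 2ky, and q times this is at most y · O(O - 1), which the δ extra bad edges supply.
    O≤k : ∀ y → O + y ≡ k → k ≤ h → 2 * k * q ≤ O * (O ∸ 1) →
      q * k * (k ∸ 1) * (h ∸ 2) ≤ (δ + q) * (O * (O ∸ 1) * (S ∸ 2))
    O≤k y refl k≤h small = begin
      q * k * (k ∸ 1) * (h ∸ 2)
        ≡⟨ cong (_* (h ∸ 2)) (*-assoc q k (k ∸ 1)) ⟩
      q * (k * (k ∸ 1)) * (h ∸ 2)
        ≤⟨ *-mono-≤ (*-monoʳ-≤ q (square O)) (∸-monoˡ-≤ 2 (≤-trans (m≤m+n h y) (≤-reflexive (sym S≡h+y)))) ⟩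
      q * (O * (O ∸ 1) + 2 * k * y) * (S ∸ 2)
        ≡⟨ l₁ q (O * (O ∸ 1)) k y (S ∸ 2) ⟩
      (q * (O * (O ∸ 1)) + y * (2 * k * q)) * (S ∸ 2)
        ≤⟨ *-monoˡ-≤ (S ∸ 2) (+-monoʳ-≤ (q * (O * (O ∸ 1))) (*-mono-≤ y≤δ small)) ⟩
      (q * (O * (O ∸ 1)) + δ * (O * (O ∸ 1))) * (S ∸ 2)
        ≡⟨ l₂ q δ (O * (O ∸ 1)) (S ∸ 2) ⟩
      (δ + q) * (O * (O ∸ 1) * (S ∸ 2)) ∎
      where
      l₁ : ∀ q x k y s → q * (x + 2 * k * y) * s ≡ (q * x + y * (2 * k * q)) * s
      l₁ = solve-∀
      l₂ : ∀ q δ x s → (q * x + δ * x) * s ≡ (δ + q) * (x * s)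
      l₂ = solve-∀
      S≡h+y : S ≡ h + y
      S≡h+y = +-cancelˡ-≡ O _ _ (trans O+S≡k+h (l O y h))
        where
        l : ∀ O y h → O + y + h ≡ O + (h + y)
        l = solve-∀
      square : ∀ O → (O + y) * (O + y ∸ 1) ≤ O * (O ∸ 1) + 2 * (O + y) * y
      square zero = begin
        y * (y ∸ 1)   ≤⟨ *-monoʳ-≤ y (m∸n≤m y 1) ⟩
        y * y         ≤⟨ m≤m+n _ _ ⟩
        y * y + y * y ≡⟨ l y ⟩
        2 * y * y     ∎
        where
        l : ∀ y → y * y + y * y ≡ 2 * y * y
        l = solve-∀
      square (suc O) = ≤-trans (m≤m+n _ (y + y * y)) (≤-reflexive (l O y))
        where
        l : ∀ O y → (suc O + y) * (O + y) + (y + y * y) ≡ suc O * O + 2 * (suc O + y) * y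
        l = solve-∀
      δ≡ : O * y + δ ≡ y * h
      δ≡ = +-cancelˡ-≡ (O * h) _ _ (trans (l₃ O h y δ) (trans (cong (λ z → O * z + δ) (sym S≡h+y)) (trans OS+δ≡kh (l₄ O y h))))
        where
        l₃ : ∀ O h y δ → O * h + (O * y + δ) ≡ O * (h + y) + δ
        l₃ = solve-∀
        l₄ : ∀ O y h → (O + y) * h ≡ O * h + y * h
        l₄ = solve-∀
      y≤y² : ∀ y → y ≤ y * y
      y≤y² zero    = z≤n
      y≤y² (suc y) = m≤m+n (suc y) _
      y≤δ : y ≤ δ
      y≤δ = +-cancelˡ-≤ (O * y) _ _ (begin
        O * y + y       ≤⟨ +-monoʳ-≤ (O * y) (y≤y² y) ⟩
        O * y + y * y   ≡⟨ l₅ O y ⟩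
        y * (O + y)     ≤⟨ *-monoʳ-≤ y k≤h ⟩
        y * h           ≡⟨ δ≡ ⟨
        O * y + δ       ∎)
        where
        l₅ : ∀ O y → O * y + y * y ≡ y * (O + y)
        l₅ = solve-∀

  -- The δ cross pairs lost by an unbalanced partition outweigh its smaller number of cycles per
  -- bad edge.
  unbalanced : h ≡ k ⊎ h ≡ suc k → 3 ≤ k → 2 ≤ S → q ≤ S ∸ 2 → 2 * k * q ≤ O * (O ∸ 1) →
    q * k * (k ∸ 1) * (h ∸ 2) ≤ (δ + q) * (O * (O ∸ 1) * (S ∸ 2))
  unbalanced h-cases 3≤k 2≤S q≤S-2 small with ≤-total k O
  ... | inj₁ k≤O with y , eq ← m≤n⇒∃[o]m+o≡n k≤O = O≥k y eq h-cases 3≤k 2≤S q≤S-2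
  ... | inj₂ O≤k′ with y , eq ← m≤n⇒∃[o]m+o≡n O≤k′ = O≤k y eq (k≤h h-cases) small
    where
    k≤h : h ≡ k ⊎ h ≡ suc k → k ≤ h
    k≤h (inj₁ h≡k)   = ≤-reflexive (sym h≡k)
    k≤h (inj₂ h≡1+k) = ≤-trans (n≤1+n k) (≤-reflexive (sym h≡1+k))

-- The count

module _ {n : ℕ} (32≤n : 32 ≤ n) (a : ℕ) (n≤8a : n ≤ 8 * a) where

  n≤16[a∸2] : n ≤ 16 * (a ∸ 2)
  n≤16[a∸2] = begin
    n             ≤⟨ m+n≤o⇒m≤o∸n n n+32≤16a ⟩
    16 * a ∸ 32   ≡⟨ *-distribˡ-∸ 16 a 2 ⟨
    16 * (a ∸ 2)  ∎
    where
    open ≤-Reasoning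
    l : ∀ a → 8 * a + 8 * a ≡ 16 * a
    l = solve-∀
    n+32≤16a : n + 32 ≤ 16 * a
    n+32≤16a = ≤-trans (+-mono-≤ n≤8a (≤-trans 32≤n n≤8a)) (≤-reflexive (l a))

  n≤16[a∸1] : n ≤ 16 * (a ∸ 1)
  n≤16[a∸1] = ≤-trans n≤16[a∸2] (*-monoʳ-≤ 16 (∸-monoʳ-≤ a (n≤1+n 1)))

  2≤a : 2 ≤ a
  2≤a = ≤-trans (m≤m+n 2 2) (*-cancelˡ-≤ 8 (≤-trans 32≤n n≤8a))

module _ {n : ℕ} (G : Graph n) (s : Fin n → Bool) where
  open Embeddings G using (E)
  open Partition G s

  private
    k h : ℕ
    k = ⌊ n /2⌋
    h = ⌈ n /2⌉

  module FewBad {P q : ℕ} (16384≤P : 16384 ≤ P) (32≤n : 32 ≤ n) (256q≤n : 256 * q ≤ n)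
    (E≡ : E ≡ 2 * (k * h + q)) (n²≤2E : n * n ≤ 2 * E)
    (small : ∀ v → P * badDeg v ≤ 2 * n) where

    private
      open ≤-Reasoning

      instance
        P≢0 : NonZero P
        P≢0 = >-nonZero (≤-trans (s≤s z≤n) 16384≤P)
        n≢0 : NonZero n
        n≢0 = >-nonZero (≤-trans (s≤s z≤n) 32≤n)

    P*B≤2n² : P * B ≤ n * (2 * n)
    P*B≤2n² = ≤-trans (≤-reflexive (sym (∑-*ˡ P badDeg))) (∑-bound small)

    4B≤n² : 4 * B ≤ n * n
    4B≤n² = *-cancelˡ-≤ 2 (begin
      2 * (4 * B)  ≡⟨ *-assoc 2 4 B ⟨
      8 * B        ≤⟨ *-monoˡ-≤ B (≤-trans (m≤m+n 8 16376) 16384≤P) ⟩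
      P * B        ≤⟨ P*B≤2n² ⟩
      n * (2 * n)  ≡⟨ l n ⟩
      2 * (n * n)  ∎)
      where
      l : ∀ n → n * (2 * n) ≡ 2 * (n * n)
      l = solve-∀

    p≤n : p ≤ n
    p≤n = ≤-trans (m≤m+n p r) (≤-reflexive p+r≡n)

    r≤n : r ≤ n
    r≤n = ≤-trans (m≤n+m r p) (≤-reflexive p+r≡n)

    n≤8p : n ≤ 8 * p
    n≤8p = *-cancelˡ-≤ n (begin
      n * n        ≤⟨ n²≤8pr G s n²≤2E 4B≤n² ⟩
      8 * (p * r)  ≡⟨ *-assoc 8 p r ⟨
      8 * p * r    ≤⟨ *-monoʳ-≤ (8 * p) r≤n ⟩
      8 * p * n    ≡⟨ *-comm (8 * p) n ⟩
      n * (8 * p)  ∎)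

    n≤8r : n ≤ 8 * r
    n≤8r = *-cancelˡ-≤ n (begin
      n * n        ≤⟨ n²≤8pr G s n²≤2E 4B≤n² ⟩
      8 * (p * r)  ≡⟨ l p r ⟩
      p * (8 * r)  ≤⟨ *-monoˡ-≤ (8 * r) p≤n ⟩
      n * (8 * r)  ∎)
      where
      l : ∀ p r → 8 * (p * r) ≡ p * (8 * r)
      l = solve-∀

    pr≤kh : p * r ≤ k * h
    pr≤kh = ≮⇒≥ λ kh<pr → <⇒≱ (n<1+n (suc (4 * (k * h)))) (begin
      2 + 4 * (k * h)         ≤⟨ +-monoˡ-≤ (4 * (k * h)) (m≤m+n 2 2) ⟩
      4 + 4 * (k * h)         ≡⟨ *-suc 4 (k * h) ⟨
      4 * suc (k * h)         ≤⟨ *-monoʳ-≤ 4 kh<pr ⟩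
      4 * (p * r)             ≤⟨ 4pr≤n² G s ⟩
      n * n                   ≤⟨ n²≤ (n²≡4kh⊎suc n) ⟩
      suc (4 * (k * h))       ∎)
      where
      n²≤ : n * n ≡ 4 * (k * h) ⊎ n * n ≡ suc (4 * (k * h)) → n * n ≤ suc (4 * (k * h))
      n²≤ (inj₁ eq) = ≤-trans (≤-reflexive eq) (n≤1+n _)
      n²≤ (inj₂ eq) = ≤-reflexive eq

    δ : ℕ
    δ = k * h ∸ p * r

    pr+δ≡kh : p * r + δ ≡ k * h
    pr+δ≡kh = m+[n∸m]≡n pr≤kh

    B≡ : B ≡ 2 * (δ + q) + M
    B≡ = +-cancelˡ-≡ (2 * (p * r)) _ _ (begin-equality
      2 * (p * r) + B                   ≡⟨ E+M≡2pr+B ⟨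
      E + M                             ≡⟨ cong (_+ M) E≡ ⟩
      2 * (k * h + q) + M               ≡⟨ cong (λ z → 2 * (z + q) + M) pr+δ≡kh ⟨
      2 * (p * r + δ + q) + M           ≡⟨ l (p * r) δ q M ⟩
      2 * (p * r) + (2 * (δ + q) + M)   ∎)
      where
      l : ∀ x δ q M → 2 * (x + δ + q) + M ≡ 2 * x + (2 * (δ + q) + M)
      l = solve-∀

    cap : ℕ → ℕ → ℕ
    cap O S = O * (O ∸ 1) * (S ∸ 2)

    -- The value 16384 = 8 · 8 · 16 · 16 arises here: the three factors of `cap` are at least n/8,
    -- n/16 and n/16, and the remaining 8 is the coefficient of the loss in `B*worst≤`.
    8n³≤P*cap : ∀ O S → n ≤ 8 * O → n ≤ 8 * S → 8 * (n * (n * n)) ≤ P * cap O S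
    8n³≤P*cap O S n≤8O n≤8S = begin
      8 * (n * (n * n))
        ≤⟨ *-monoʳ-≤ 8 (*-mono-≤ n≤8O (*-mono-≤ (n≤16[a∸1] 32≤n O n≤8O) (n≤16[a∸2] 32≤n S n≤8S))) ⟩
      8 * (8 * O * (16 * (O ∸ 1) * (16 * (S ∸ 2))))
        ≡⟨ l O (O ∸ 1) (S ∸ 2) ⟩
      16384 * (O * (O ∸ 1) * (S ∸ 2))
        ≤⟨ *-monoˡ-≤ (O * (O ∸ 1) * (S ∸ 2)) 16384≤P ⟩
      P * cap O S ∎
      where
      l : ∀ a b c → 8 * (8 * a * (16 * b * (16 * c))) ≡ 16384 * (a * b * c)
      l = solve-∀

    target : ℕ
    target = q * k * (k ∸ 1) * (h ∸ 2)

    target≤ : ∀ O S → O + S ≡ n → O * S + δ ≡ k * h → n ≤ 8 * O → n ≤ 8 * S →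
      target ≤ (δ + q) * cap O S
    target≤ O S O+S≡n OS+δ≡kh n≤8O n≤8S =
      unbalanced (trans O+S≡n (sym (⌊n/2⌋+⌈n/2⌉≡n n))) OS+δ≡kh (⌈n/2⌉≡⌊n/2⌋⊎suc n)
        (≤-trans (m≤m+n 3 13) (⌊n/2⌋-mono 32≤n)) (2≤a 32≤n S n≤8S)
        (*-cancelˡ-≤ 16 (begin
          16 * q         ≤⟨ *-monoˡ-≤ q (m≤m+n 16 240) ⟩
          256 * q        ≤⟨ 256q≤n ⟩
          n              ≤⟨ n≤16[a∸2] 32≤n S n≤8S ⟩
          16 * (S ∸ 2)   ∎))
        (*-cancelˡ-≤ 128 (begin
          128 * (2 * k * q)          ≡⟨ l₁ k q ⟩
          k * (256 * q)              ≤⟨ *-mono-≤ (⌊n/2⌋≤n n) 256q≤n ⟩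
          n * n                      ≤⟨ *-mono-≤ n≤8O (n≤16[a∸1] 32≤n O n≤8O) ⟩
          8 * O * (16 * (O ∸ 1))     ≡⟨ l₂ O (O ∸ 1) ⟩
          128 * (O * (O ∸ 1))        ∎))
      where
      l₁ : ∀ k q → 128 * (2 * k * q) ≡ k * (256 * q)
      l₁ = solve-∀
      l₂ : ∀ a b → 8 * a * (16 * b) ≡ 128 * (a * b)
      l₂ = solve-∀

    -- A minimum over the two sides, so that it does not matter how the bad edges are distributed
    -- between the parts.
    worst : ℕ
    worst = cap r p ⊓ cap p r

    worst≤capacity : ∀ u → worst ≤ capacity G s u
    worst≤capacity u = go (s u) refl
      where
      go : ∀ b → s u ≡ b → worst ≤ capacity G s u
      go true  eq with sizes-true u eq
      ... | in≡ , out≡ rewrite in≡ | out≡ = m⊓n≤m _ _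
      go false eq with sizes-false u eq
      ... | in≡ , out≡ rewrite in≡ | out≡ = m⊓n≤n (cap r p) _

    8n³≤P*worst : 8 * (n * (n * n)) ≤ P * worst
    8n³≤P*worst = ≤-trans (⊓-glb (8n³≤P*cap r p n≤8r n≤8p) (8n³≤P*cap p r n≤8p n≤8r))
                          (≤-reflexive (sym (*-distribˡ-⊓ P (cap r p) (cap p r))))

    target≤worst : target ≤ (δ + q) * worst
    target≤worst = ≤-trans
      (⊓-glb (target≤ r p (trans (+-comm r p) p+r≡n) (trans (cong (_+ δ) (*-comm r p)) pr+δ≡kh) n≤8r n≤8p)
             (target≤ p r p+r≡n pr+δ≡kh n≤8p n≤8r))
      (≤-reflexive (sym (*-distribˡ-⊓ (δ + q) (cap r p) (cap p r))))

    P*V≤2nM : P * V G s ≤ 2 * n * M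
    P*V≤2nM = begin
      P * V G s
        ≡⟨ ∑-*ˡ P _ ⟨
      ∑ (λ u → P * (badDeg u * misDeg u))
        ≤⟨ ∑-mono (λ u → ≤-trans (≤-reflexive (sym (*-assoc P (badDeg u) (misDeg u))))
                                 (*-monoˡ-≤ (misDeg u) (small u))) ⟩
      ∑ (λ u → 2 * n * misDeg u)
        ≡⟨ ∑-*ˡ (2 * n) misDeg ⟩
      2 * n * M ∎

    -- Both kinds of loss have the same order: P · V ≤ 2nM and P · B ≤ 2n² each contribute 4n³M.
    B*worst≤ : P * (B * worst) ≤ P * W + 8 * (n * (n * n)) * M
    B*worst≤ = begin
      P * (B * worst)
        ≤⟨ *-monoʳ-≤ P (≤-trans (≤-reflexive (sym (∑-*ʳ worst badDeg)))
             (≤-trans (∑-mono (λ u → *-monoʳ-≤ (badDeg u) (worst≤capacity u))) (Σbad*capacity≤ G s))) ⟩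
      P * (W + 2 * (n * (n * V G s) + n * (B * M)))
        ≡⟨ l₁ P W n (V G s) B M ⟩
      P * W + 2 * (n * (n * (P * V G s)) + n * (P * B * M))
        ≤⟨ +-monoʳ-≤ (P * W) (*-monoʳ-≤ 2 (+-mono-≤ (*-monoʳ-≤ n (*-monoʳ-≤ n P*V≤2nM))
             (*-monoʳ-≤ n (*-monoˡ-≤ M P*B≤2n²)))) ⟩
      P * W + 2 * (n * (n * (2 * n * M)) + n * (n * (2 * n) * M))
        ≡⟨ l₂ P W n M ⟩
      P * W + 8 * (n * (n * n)) * M ∎
      where
      l₁ : ∀ P W n V B M → P * (W + 2 * (n * (n * V) + n * (B * M))) ≡
        P * W + 2 * (n * (n * (P * V)) + n * (P * B * M))
      l₁ = solve-∀
      l₂ : ∀ P W n M → P * W + 2 * (n * (n * (2 * n * M)) + n * (n * (2 * n) * M)) ≡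
        P * W + 8 * (n * (n * n)) * M
      l₂ = solve-∀

    -- B exceeds 2(δ + q) by the number M of missing pairs, which pays for the cycles they destroy.
    2*target≤W : 2 * target ≤ W
    2*target≤W = ≤-trans (*-monoʳ-≤ 2 target≤worst)
      (*-cancelˡ-≤ P (+-cancelʳ-≤ (P * worst * M) _ _ (begin
        P * (2 * ((δ + q) * worst)) + P * worst * M
          ≡⟨ l P (δ + q) worst M ⟩
        P * ((2 * (δ + q) + M) * worst)
          ≡⟨ cong (λ z → P * (z * worst)) B≡ ⟨
        P * (B * worst)
          ≤⟨ B*worst≤ ⟩
        P * W + 8 * (n * (n * n)) * M
          ≤⟨ +-monoʳ-≤ (P * W) (*-monoˡ-≤ M 8n³≤P*worst) ⟩
        P * W + P * worst * M ∎)))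
      where
      l : ∀ P d w M → P * (2 * (d * w)) + P * w * M ≡ P * ((2 * d + M) * w)
      l = solve-∀

-- From few five-cycles to a partition with small bad degrees, and the resulting bound

module _ {P Q D n : ℕ} (16384≤P : 16384 ≤ P) (Q≡ : Q ≡ 128 * (P * P))
  (384Q²≤D : 384 * (Q * Q) ≤ D) (8QD≤n : 8 * Q * D ≤ n) (n≤16QD : n ≤ 16 * Q * D) where

  private
    open ≤-Reasoning

    instance
      P≢0 : NonZero P
      P≢0 = >-nonZero (≤-trans (s≤s z≤n) 16384≤P)
      Q≢0 : NonZero Q
      Q≢0 = subst NonZero (sym Q≡) (m*n≢0 128 (P * P) {{_}} {{m*n≢0 P P}})
      D≢0 : NonZero D
      D≢0 = >-nonZero (≤-trans (>-nonZero⁻¹ (384 * (Q * Q)) {{m*n≢0 384 (Q * Q) {{_}} {{m*n≢0 Q Q}}}}) 384Q²≤D)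
      n≢0 : NonZero n
      n≢0 = >-nonZero (≤-trans (>-nonZero⁻¹ (8 * Q * D) {{m*n≢0 (8 * Q) D {{m*n≢0 8 Q}}}}) 8QD≤n)

  -- The cut-off `D` balances two errors. Being at most n/(8Q), it keeps the charge for small
  -- codegrees to half of the allowed total; being at least n/(16Q) and 384Q², it satisfies 24Qn ≤
  -- D², so the terms of order n⁴ fit into the other half.
  few-triangles : ∀ {T X} → X ≤ n * (n * (n * n)) →
    D * D * T ≤ X + 5 * (n * (n * (n * n))) + 2 * (n * (n * (D * (D * D)))) → 2 * Q * T ≤ n * (n * n)
  few-triangles {T} {X} X≤n⁴ bound = *-cancelˡ-≤ (2 * (D * D)) {{m*n≢0 2 (D * D) {{_}} {{m*n≢0 D D}}}} (begin
    2 * (D * D) * (2 * Q * T)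
      ≡⟨ l₁ D Q T ⟩
    4 * Q * (D * D * T)
      ≤⟨ *-monoʳ-≤ (4 * Q) (≤-trans bound (+-monoˡ-≤ _ (+-monoˡ-≤ _ X≤n⁴))) ⟩
    4 * Q * (n * (n * (n * n)) + 5 * (n * (n * (n * n))) + 2 * (n * (n * (D * (D * D)))))
      ≡⟨ l₂ Q n D ⟩
    24 * Q * n * (n * (n * n)) + 8 * Q * D * (n * (n * (D * D)))
      ≤⟨ +-mono-≤ (*-monoˡ-≤ (n * (n * n)) 24Qn≤D²) (*-monoˡ-≤ (n * (n * (D * D))) 8QD≤n) ⟩
    D * D * (n * (n * n)) + n * (n * (n * (D * D)))
      ≡⟨ l₃ n D ⟩
    2 * (D * D) * (n * (n * n)) ∎)
    where
    l₁ : ∀ D Q T → 2 * (D * D) * (2 * Q * T) ≡ 4 * Q * (D * D * T)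
    l₁ = solve-∀
    l₂ : ∀ Q n D → 4 * Q * (n * (n * (n * n)) + 5 * (n * (n * (n * n))) + 2 * (n * (n * (D * (D * D))))) ≡
      24 * Q * n * (n * (n * n)) + 8 * Q * D * (n * (n * (D * D)))
    l₂ = solve-∀
    l₃ : ∀ n D → D * D * (n * (n * n)) + n * (n * (n * (D * D))) ≡ 2 * (D * D) * (n * (n * n))
    l₃ = solve-∀
    l₄ : ∀ Q D → 24 * Q * (16 * Q * D) ≡ 384 * (Q * Q) * D
    l₄ = solve-∀
    24Qn≤D² : 24 * Q * n ≤ D * D
    24Qn≤D² = begin
      24 * Q * n               ≤⟨ *-monoʳ-≤ (24 * Q) n≤16QD ⟩
      24 * Q * (16 * Q * D)    ≡⟨ l₄ Q D ⟩
      384 * (Q * Q) * D        ≤⟨ *-monoˡ-≤ D 384Q²≤D ⟩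
      D * D                    ∎

  4≤Q : 4 ≤ Q
  4≤Q = begin
    4              ≤⟨ m≤m+n 4 124 ⟩
    128            ≤⟨ m≤m*n 128 (P * P) {{m*n≢0 P P}} ⟩
    128 * (P * P)  ≡⟨ Q≡ ⟨
    Q              ∎

  Q≤n : Q ≤ n
  Q≤n = begin
    Q              ≤⟨ m≤n*m Q 8 ⟩
    8 * Q          ≤⟨ m≤m*n (8 * Q) D ⟩
    8 * Q * D      ≤⟨ 8QD≤n ⟩
    n              ∎

  2P²≤Q : 2 * (P * P) ≤ Q
  2P²≤Q = ≤-trans (*-monoˡ-≤ (P * P) (m≤m+n 2 126)) (≤-reflexive (sym Q≡))

  module _ (G : Graph n) where
    open Embeddings G
    open Triangles G

    nearlyBipartite : n * n ≤ 2 * E → Q * Σ₅ cyc ≤ n * (n * (n * n)) →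
      ∃ λ s → ∀ v → P * Partition.badDeg G s v ≤ 2 * n
    nearlyBipartite n²≤2E cycs with x , nB≤2T ← sparseNeighbourhood n²≤2E =
      Reassign.s′ G s P , Reassign.P*badDeg≤2n G s P
        (one-sided G s {P} {Q} Q≡ cycs (≤-trans (*-monoʳ-≤ Q M≤B′) QB≤n²) Q≤n n²≤8pr′)
        2n≤Pp few
      where
      s : Fin n → Bool
      s = adj x
      open Partition G s using (B; M; p; r; p+r≡n)
      QB≤n² : Q * B ≤ n * n
      QB≤n² = *-cancelˡ-≤ n (begin
        n * (Q * B)  ≡⟨ l₁ n Q B ⟩
        Q * (n * B)  ≤⟨ *-monoʳ-≤ Q nB≤2T ⟩
        Q * (2 * T)  ≡⟨ l₂ Q T ⟩
        2 * Q * T    ≤⟨ few-triangles (≤-trans (m≤n*m _ Q) cycs) (triangles≤ D) ⟩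
        n * (n * n)  ∎)
        where
        l₁ : ∀ n Q B → n * (Q * B) ≡ Q * (n * B)
        l₁ = solve-∀
        l₂ : ∀ Q T → Q * (2 * T) ≡ 2 * Q * T
        l₂ = solve-∀
      M≤B′ : M ≤ B
      M≤B′ = M≤B G s n²≤2E
      n²≤8pr′ : n * n ≤ 8 * (p * r)
      n²≤8pr′ = n²≤8pr G s n²≤2E (≤-trans (*-monoˡ-≤ B 4≤Q) QB≤n²)
      few : P * P * (B + M) ≤ n * n
      few = begin
        P * P * (B + M)    ≤⟨ *-monoʳ-≤ (P * P) (+-monoʳ-≤ B M≤B′) ⟩
        P * P * (B + B)    ≡⟨ l (P * P) B ⟩
        2 * (P * P) * B    ≤⟨ *-monoˡ-≤ B 2P²≤Q ⟩
        Q * B              ≤⟨ QB≤n² ⟩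
        n * n              ∎
        where
        l : ∀ x B → x * (B + B) ≡ 2 * x * B
        l = solve-∀
      2n≤Pp : 2 * n ≤ P * p
      2n≤Pp = *-cancelʳ-≤ _ _ n (begin
        2 * n * n            ≡⟨ *-assoc 2 n n ⟩
        2 * (n * n)          ≤⟨ *-monoʳ-≤ 2 n²≤8pr′ ⟩
        2 * (8 * (p * r))    ≡⟨ l p r ⟩
        16 * p * r           ≤⟨ *-mono-≤ (*-monoˡ-≤ p (≤-trans (m≤m+n 16 16368) 16384≤P))
                                         (≤-trans (m≤n+m r p) (≤-reflexive p+r≡n)) ⟩
        P * p * n            ∎)
        where
        l : ∀ p r → 2 * (8 * (p * r)) ≡ 16 * p * r
        l = solve-∀

    copies : ∀ {q} → 1 ≤ q → 10 * Q * q ≤ n → numEdges G ≡ (n ^ 2) / 4 + q →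
      q * ⌊ n /2⌋ * (⌊ n /2⌋ ∸ 1) * (⌈ n /2⌉ ∸ 2) ≤ numC₅ G
    copies {q} 1≤q 10Qq≤n edges = begin
      F                       ≡⟨ m*n/n≡m F 10 ⟨
      F * 10 / 10             ≤⟨ /-monoˡ-≤ 10 F*10≤ ⟩
      numEmbeddings C₅ G / 10 ∎
      where
      k h F : ℕ
      k = ⌊ n /2⌋
      h = ⌈ n /2⌉
      F = q * k * (k ∸ 1) * (h ∸ 2)
      E≡ : E ≡ 2 * (k * h + q)
      E≡ = trans E≡2*numEdges (cong (2 *_) (trans edges (cong (_+ q) (n²/4≡kh n))))
      n²≤2E : n * n ≤ 2 * E
      n²≤2E = begin
        n * n                      ≤⟨ n²≤ (n²≡4kh⊎suc n) ⟩
        4 * (k * h) + 1            ≤⟨ +-monoʳ-≤ (4 * (k * h)) (≤-trans 1≤q (m≤n*m q 4)) ⟩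
        4 * (k * h) + 4 * q        ≡⟨ l (k * h) q ⟩
        2 * (2 * (k * h + q))      ≡⟨ cong (2 *_) E≡ ⟨
        2 * E                      ∎
        where
        l : ∀ x q → 4 * x + 4 * q ≡ 2 * (2 * (x + q))
        l = solve-∀
        n²≤ : n * n ≡ 4 * (k * h) ⊎ n * n ≡ suc (4 * (k * h)) → n * n ≤ 4 * (k * h) + 1
        n²≤ (inj₁ eq) = ≤-trans (≤-reflexive eq) (m≤m+n _ 1)
        n²≤ (inj₂ eq) = ≤-reflexive (trans eq (+-comm 1 _))
      -- The linear bound on `q` enters here: `F` is at most q · n³, and 10 · Q · q ≤ n absorbs the
      -- remaining factors.
      few-cycles : Σ₅ cyc < F * 10 → Q * Σ₅ cyc ≤ n * (n * (n * n))
      few-cycles lt = begin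
        Q * Σ₅ cyc
          ≤⟨ *-monoʳ-≤ Q (<⇒≤ lt) ⟩
        Q * (F * 10)
          ≡⟨ l Q q k (k ∸ 1) (h ∸ 2) ⟩
        10 * Q * q * (k * ((k ∸ 1) * (h ∸ 2)))
          ≤⟨ *-mono-≤ 10Qq≤n (*-mono-≤ (⌊n/2⌋≤n n) (*-mono-≤ (≤-trans (m∸n≤m k 1) (⌊n/2⌋≤n n))
               (≤-trans (m∸n≤m h 2) (⌈n/2⌉≤n n)))) ⟩
        n * (n * (n * n)) ∎
        where
        l : ∀ Q q a b c → Q * (q * a * b * c * 10) ≡ 10 * Q * q * (a * (b * c))
        l = solve-∀
      32≤n : 32 ≤ n
      32≤n = begin
        32               ≤⟨ m≤m+n 32 96 ⟩
        128              ≤⟨ m≤m*n 128 (P * P) {{m*n≢0 P P}} ⟩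
        128 * (P * P)    ≡⟨ Q≡ ⟨
        Q                ≤⟨ Q≤n ⟩
        n                ∎
      256q≤n : 256 * q ≤ n
      256q≤n = ≤-trans (*-monoˡ-≤ q 256≤10Q) 10Qq≤n
        where
        256≤10Q : 256 ≤ 10 * Q
        256≤10Q = begin
          256                    ≤⟨ m≤m+n 256 1024 ⟩
          10 * 128               ≤⟨ *-monoʳ-≤ 10 (m≤m*n 128 (P * P) {{m*n≢0 P P}}) ⟩
          10 * (128 * (P * P))   ≡⟨ cong (10 *_) Q≡ ⟨
          10 * Q                 ∎
      -- The 10 embeddings of each copy appear as 5 · 2: five positions of the bad edge in the
      -- cycle, and two orientations, which `W` already includes because bad pairs are ordered.
      saturated : (∃ λ s → ∀ v → P * Partition.badDeg G s v ≤ 2 * n) → F * 10 ≤ Σ₅ cyc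
      saturated (s , small) = begin
        F * 10              ≡⟨ l F ⟩
        5 * (2 * F)         ≤⟨ *-monoʳ-≤ 5 (FewBad.2*target≤W G s {P} {q} 16384≤P 32≤n 256q≤n E≡ n²≤2E small) ⟩
        5 * Partition.W G s ≤⟨ Partition.5W≤Σcyc G s ⟩
        Σ₅ cyc              ∎
        where
        l : ∀ F → F * 10 ≡ 5 * (2 * F)
        l = solve-∀
      F*10≤Σcyc : F * 10 ≤ Σ₅ cyc
      F*10≤Σcyc = ≮⇒≥ λ few → <⇒≱ few (saturated (nearlyBipartite n²≤2E (few-cycles few)))
      F*10≤ : F * 10 ≤ numEmbeddings C₅ G
      F*10≤ = ≤-trans F*10≤Σcyc Σcyc≤numEmbeddings

-- The rational constant and the threshold for n

-- Rational arithmetic normalises fractions, which blocks computation with variable numerators. The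
-- inequality is therefore transported to unnormalised rationals, where it is a comparison of
-- explicit products.
<-scale : ∀ K .{{_ : NonZero K}} q n →
  ((+ q) /ℚ 1) <ℚ (((+ 1) /ℚ K) *ℚ ((+ n) /ℚ 1)) → K * q < n
<-scale (suc j) q n lt
  with *<* ineq ← ℚᵘ.<-respˡ-≃ (toℚᵘ-fromℚᵘ (mkℚᵘ (+ q) 0))
       (ℚᵘ.<-respʳ-≃ (ℚᵘ.≃-trans (toℚᵘ-homo-* ((+ 1) /ℚ suc j) ((+ n) /ℚ 1))
         (ℚᵘ.*-cong (toℚᵘ-fromℚᵘ (mkℚᵘ (+ 1) j)) (toℚᵘ-fromℚᵘ (mkℚᵘ (+ n) 0)))) (toℚᵘ-mono-< lt)) =
  subst₂ _<_ (l₁ q j) (l₂ n)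
    (ℤ.drop‿+<+ (subst₂ ℤ._<_ (sym (ℤ.pos-* q _))
      (trans (cong (ℤ._* + 1) (sym (ℤ.pos-* 1 n))) (sym (ℤ.pos-* (1 * n) 1))) ineq))
  where
  l₁ : ∀ q j → q * (suc j * 1) ≡ suc j * q
  l₁ = solve-∀
  l₂ : ∀ n → 1 * n * 1 ≡ n
  l₂ = solve-∀

module _ (n N U : ℕ) .{{_ : NonZero U}} (large : suc N * U ≤ n) where

  N<n/U : N < n / U
  N<n/U = ≤-trans (≤-reflexive (sym (m*n/n≡m (suc N) U))) (/-monoˡ-≤ U large)

  n≤2[n/U]U : n ≤ 2 * (n / U * U)
  n≤2[n/U]U = begin
    n                          ≡⟨ m≡m%n+[m/n]*n n U ⟩
    n % U + n / U * U          ≤⟨ +-monoˡ-≤ (n / U * U) (<⇒≤ (m%n<n n U)) ⟩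
    U + n / U * U              ≤⟨ +-monoˡ-≤ (n / U * U) (m≤n*m U (n / U) {{>-nonZero (≤-trans (s≤s z≤n) N<n/U)}}) ⟩
    n / U * U + n / U * U      ≡⟨ cong (λ t → n / U * U + t) (+-identityʳ _) ⟨
    2 * (n / U * U)            ∎
    where open ≤-Reasoning

-- The constants are variables here because their values are too large to be unfolded in unary.
with-constants : ∀ P Q U K N → 16384 ≤ P → Q ≡ 128 * (P * P) → U ≡ 8 * Q → K ≡ 10 * Q →
  N ≡ 384 * (Q * Q) → .{{_ : NonZero K}} → .{{_ : NonZero U}} →
  ∃[ c ] (0ℚ <ℚ c ×
    (∃[ n₀ ] (∀ (n : ℕ) → n₀ ≤ n →
    ∀ (q : ℕ) → 1 ≤ q → ((+ q) /ℚ 1) <ℚ (c *ℚ ((+ n) /ℚ 1)) →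
    ∀ (G : Graph n) → numEdges G ≡ (n ^ 2) / 4 + q →
    q * ⌊ n /2⌋ * (⌊ n /2⌋ ∸ 1) * (⌈ n /2⌉ ∸ 2) ≤ numC₅ G)))
with-constants P Q U K N 16384≤P Q≡ U≡ K≡ N≡ =
  (+ 1) /ℚ K , positive⁻¹ ((+ 1) /ℚ K) {{normalize-pos 1 K}} , suc N * U , bound
  where
  bound : ∀ n → suc N * U ≤ n → ∀ q → 1 ≤ q → ((+ q) /ℚ 1) <ℚ (((+ 1) /ℚ K) *ℚ ((+ n) /ℚ 1)) →
    (G : Graph n) → numEdges G ≡ (n ^ 2) / 4 + q →
    q * ⌊ n /2⌋ * (⌊ n /2⌋ ∸ 1) * (⌈ n /2⌉ ∸ 2) ≤ numC₅ G
  bound n large q 1≤q q<cn G edges =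
    -- The cut-off `D` is n divided by 8Q, rounded down. The threshold `suc N * U` for n makes this
    -- quotient exceed `N`; being positive, it loses at most a factor 2 to rounding, which is why
    -- 16Q stands against 8Q in the two bounds on `D`.
    go (n / U) (<⇒≤ (N<n/U n N U large)) (m/n*n≤m n U) (n≤2[n/U]U n N U large)
    where
    go : ∀ D → N ≤ D → D * U ≤ n → n ≤ 2 * (D * U) →
      q * ⌊ n /2⌋ * (⌊ n /2⌋ ∸ 1) * (⌈ n /2⌉ ∸ 2) ≤ numC₅ G
    go D N≤D DU≤n n≤2DU = copies {P} {Q} {D} {n} 16384≤P Q≡ (≤-trans (≤-reflexive (sym N≡)) N≤D)
      (≤-trans (≤-reflexive (trans (*-comm (8 * Q) D) (cong (D *_) (sym U≡)))) DU≤n)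
      (≤-trans n≤2DU (≤-reflexive (trans (cong (λ u → 2 * (D * u)) U≡) (l D Q)))) G 1≤q
      (≤-trans (≤-reflexive (cong (_* q) (sym K≡))) (<⇒≤ (<-scale K q n q<cn))) edges
      where
      l : ∀ D Q → 2 * (D * (8 * Q)) ≡ 16 * Q * D
      l = solve-∀

mainTheorem2 : ∃[ c ] (0ℚ <ℚ c ×
    (∃[ n₀ ] (∀ (n : ℕ) → n₀ ≤ n →
    ∀ (q : ℕ) → 1 ≤ q → ((+ q) /ℚ 1) <ℚ (c *ℚ ((+ n) /ℚ 1)) →
    ∀ (G : Graph n) → numEdges G ≡ (n ^ 2) / 4 + q →
    q * ⌊ n /2⌋ * (⌊ n /2⌋ ∸ 1) * (⌈ n /2⌉ ∸ 2) ≤ numC₅ G)))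
-- These are P = 2^14, Q = 128P² = 2^35, U = 8Q = 2^38 and K = 10Q, so c = 1/(10 · 2^35).
mainTheorem2 = with-constants 16384 34359738368 274877906944 343597383680
  (384 * (34359738368 * 34359738368)) ≤-refl refl refl refl refl
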